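{- There is an absolute constant $c$ such that for every $0<\delta\leq 1$, every $(d,\Delta)$-degenerate graph $H$ with chromatic number $q$ and $n$ vertices satisfies $$r(H) < 2^{c q 3^q d/\delta}\,\Delta^{c\delta}\, n.$$
   Context: The Ramsey number $r(H)$ of a graph $H$ is the least positive integer $N$ such that every two-coloring of the edges of $K_N$ contains a monochromatic copy of $H$. A graph $H$ is $(d,\Delta)$-degenerate if there is an ordering $v_1,\ldots,v_n$ of its vertices such that for each $v_i$: (1) at most $d$ vertices $v_j$ with $j<i$ are adjacent to $v_i$, and (2) there are at most $\Delta$ subsets $S\subset\{v_1,\ldots,v_i\}$ such that $S=N(v_j)\cap\{v_1,\ldots,v_i\}$ for some neighbor $v_j$ of $v_i$ with $j>i$, where $N(v)$ is the set of neighbors of $v$.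
   Formalization: The parameter δ ranges over rationals p/s in (0,1], with the inequality raised to the power ps; real δ follows after doubling c. The degenerate cases n = 0, d = 0 (edgeless graphs) and Δ = 0 are excluded. -}

module Defs where

open import Data.Nat using (ℕ; zero; suc; _≤_; _<_)
open import Data.Bool using (Bool; true; false; _∧_)
import Data.Bool.Properties as BoolP
open import Data.Fin using (Fin; toℕ)
import Data.Nat as Nat
open import Data.Fin.Permutation using (Permutation′; _⟨$⟩ʳ_)
open import Data.Vec using (Vec; tabulate)
import Data.Vec.Properties as VecP
open import Data.List using (List; length; filterᵇ; map; deduplicate; allFin)
open import Data.Product using (Σ; _×_)
open import Function.Definitions using (Injective)
open import Relation.Binary.PropositionalEquality using (_≡_)

record Graph (n : ℕ) : Set where
  field
    Adj    : Fin n → Fin n → Bool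
    sym    : ∀ i j → Adj i j ≡ Adj j i
    irrefl : ∀ i → Adj i i ≡ false
open Graph public

-- A red/blue colouring of the edges of K_N: a symmetric Bool-valued function
-- on pairs (values on the diagonal are irrelevant).
record Colouring (N : ℕ) : Set where
  field
    col    : Fin N → Fin N → Bool
    colSym : ∀ i j → col i j ≡ col j i
open Colouring public

MonoCopy : ∀ {n N} → Graph n → Colouring N → Set
MonoCopy {n} {N} H χ =
  Σ (Fin n → Fin N) λ f → Injective _≡_ _≡_ f ×
  Σ Bool λ b → ∀ i j → Adj H i j ≡ true → col χ (f i) (f j) ≡ b

Arrows : ∀ {n} → ℕ → Graph n → Set
Arrows N H = (χ : Colouring N) → MonoCopy H χ

IsRamseyNumber : ∀ {n} → Graph n → ℕ → Set
IsRamseyNumber H r =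
  (1 ≤ r × Arrows r H) × (∀ m → 1 ≤ m → Arrows m H → r ≤ m)

ProperColouring : ∀ {n} → Graph n → ℕ → Set
ProperColouring {n} H q =
  Σ (Fin n → Fin q) λ κ → ∀ i j → Adj H i j ≡ true → ¬≡ (κ i) (κ j)
  where
  open import Relation.Nullary using (¬_)
  ¬≡ : Fin q → Fin q → Set
  ¬≡ a b = ¬ (a ≡ b)

IsChromaticNumber : ∀ {n} → Graph n → ℕ → Set
IsChromaticNumber H q = ProperColouring H q × (∀ m → ProperColouring H m → q ≤ m)

_<ᵇ_ : ∀ {n} → Fin n → Fin n → Bool
a <ᵇ b = toℕ a Nat.<ᵇ toℕ b

_≤ᵇ_ : ∀ {n} → Fin n → Fin n → Bool
a ≤ᵇ b = toℕ a Nat.≤ᵇ toℕ b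

countᵇ : ∀ {n} → (Fin n → Bool) → ℕ
countᵇ {n} p = length (filterᵇ p (allFin n))

-- (d,Δ)-degeneracy.  The ordering v_1,…,v_n is given by a permutation π:
-- v_i = π ⟨$⟩ʳ i (positions are 0-based, which is immaterial).
-- For position i and a later position j, the trace of v_j on {v_1,…,v_i},
-- i.e. N(v_j) ∩ {v_1,…,v_i}, is recorded as a subset of positions
-- (a Vec Bool n whose k-th entry says whether v_k is in the set).
module _ {n : ℕ} (H : Graph n) (π : Permutation′ n) where
  v : Fin n → Fin n
  v i = π ⟨$⟩ʳ i

  backDegree : Fin n → ℕ
  backDegree i = countᵇ (λ j → (j <ᵇ i) ∧ Adj H (v i) (v j))

  trace : Fin n → Fin n → Vec Bool n
  trace i j = tabulate (λ k → (k ≤ᵇ i) ∧ Adj H (v j) (v k))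

  numTraces : Fin n → ℕ
  numTraces i =
    length (deduplicate (VecP.≡-dec BoolP._≟_)
      (map (trace i)
        (filterᵇ (λ j → (i <ᵇ j) ∧ Adj H (v i) (v j)) (allFin n))))

Degenerate : ∀ {n} → Graph n → ℕ → ℕ → Set
Degenerate {n} H d Δ =
  Σ (Permutation′ n) λ π →
    ∀ i → backDegree H π i ≤ d × numTraces H π i ≤ Δ

{-# OPTIONS --safe #-}
-- Dependent random choice is iterated 2q times inside a two-coloured K_N.  From the
-- current vertex set A one picks a t-tuple T and a colour c for which the common
-- c-neighbourhood of T in A is large, while few tuples S have all their vertices
-- c-adjacent to T and yet have few common c-neighbours in A; then A shrinks to
-- A ∩ N_c(T).  The tuples counted at earlier steps are long enough to contain all
-- tuples T chosen later, so averaging over T controls the tuples S for which the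
-- set B = A ∩ N_{c'}(T₁) ∩ N_{c'}(T₂) ∩ … of an earlier step (of colour c', with
-- later choices T₁, T₂, …) contains few common neighbours of S.  Some q of the 2q
-- steps share a colour, and their sets B receive the q colour classes of H.  H is
-- embedded greedily along its ordering, keeping, for every later vertex, the image
-- of its earlier neighbours contained in few bad d-tuples; each vertex only has to
-- respect Δ traces, and each trace rules out fewer than n/Δ candidates.
module Submission where

open import Defs hiding (sym; _<ᵇ_)
open import Data.Bool using (Bool; true; false; _∧_; _≟_; if_then_else_; T?)
open import Data.Bool.ListAction using (all)
open import Data.Bool.Properties using (∧-assoc; ∧-comm; ∧-identityʳ; T-≡)
open import Data.Fin using (Fin; zero; suc; toℕ; fromℕ<; inject≤)
open import Data.Fin.Permutation using (Permutation′; _⟨$⟩ʳ_; _⟨$⟩ˡ_; inverseʳ)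
import Data.Fin.Properties as Fin
open import Data.List using (List; []; _∷_; _++_; map; length; filter; filterᵇ; allFin; deduplicate; lookup)
import Data.List as List
open import Data.List.Membership.Propositional using (_∈_)
open import Data.List.Membership.Propositional.Properties using (∈-lookup; ∈-filter⁺; ∈-filter⁻; ∈-map⁺; ∈-map⁻; ∈-deduplicate⁺; ∈-deduplicate⁻; ∈-allFin)
open import Data.List.Properties using (length-map; length-++)
open import Data.List.Relation.Unary.All as All using (All; []; _∷_)
import Data.List.Relation.Unary.All.Properties as AllP
open import Data.List.Relation.Unary.AllPairs as AllPairs using (AllPairs; []; _∷_)
import Data.List.Relation.Unary.AllPairs.Properties as AllPairsP
open import Data.List.Relation.Unary.Any using (here; there)
open import Data.Nat using (ℕ; zero; suc; _+_; _*_; _∸_; _^_; _≤_; _<_; _<ᵇ_; _<?_; z≤n; s≤s; NonZero; >-nonZero)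
import Data.Nat as Nat
open import Data.Nat.DivMod using (_/_; _%_; m/n*n≤m; m%n<n; m≡m%n+[m/n]*n)
open import Data.Nat.ListAction using () renaming (sum to sumᴸ)
open import Data.Nat.Properties hiding (_≟_)
open import Algebra.Properties.Semiring.Sum +-*-semiring using (sum; sum-syntax; sum-cong-≗; sum-replicate-zero; ∑-distrib-+; ∑-comm; *-distribˡ-sum)
open import Data.Nat.Tactic.RingSolver using (solve-∀)
open import Data.Product using (Σ; ∃; ∃₂; _×_; _,_; proj₁; proj₂)
open import Data.Sum using (_⊎_; inj₁; inj₂)
open import Data.Vec using (Vec; []; _∷_; tabulate)
open import Data.Vec.Functional using (updateAt)
open import Data.Vec.Functional.Properties using (updateAt-updates; updateAt-minimal)
open import Data.Vec.Properties using (≡-dec; tabulate-cong)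
open import Function using (_∘_; id; const; case_of_; Equivalence)
open import Relation.Binary.Definitions using (tri<; tri≈; tri>)
open import Relation.Binary.PropositionalEquality
open import Relation.Nullary using (Dec; yes; no; ¬?; contradiction; does)
open import Relation.Nullary.Decidable using (dec-true)

-- Arithmetic, indicators and finite sums.

^-distribʳ-* : ∀ k m n → (m * n) ^ k ≡ m ^ k * n ^ k
^-distribʳ-* zero    m n = refl
^-distribʳ-* (suc k) m n = trans (cong (m * n *_) (^-distribʳ-* k m n)) (shuffle m n (m ^ k) (n ^ k))
  where
  shuffle : ∀ a b c d → a * b * (c * d) ≡ a * c * (b * d)
  shuffle = solve-∀

∧-true⁻ : ∀ {a b} → a ∧ b ≡ true → a ≡ true × b ≡ true
∧-true⁻ {true} {true} _ = refl , refl

∧-true⁺ : ∀ {a b} → a ≡ true → b ≡ true → a ∧ b ≡ true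
∧-true⁺ refl refl = refl

𝟙 : Bool → ℕ
𝟙 false = 0
𝟙 true  = 1

𝟙-∧ : ∀ a b → 𝟙 (a ∧ b) ≡ 𝟙 a * 𝟙 b
𝟙-∧ false b = refl
𝟙-∧ true  b = sym (+-identityʳ (𝟙 b))

sum-mono-≤ : ∀ {n} {f g : Fin n → ℕ} → (∀ i → f i ≤ g i) → sum f ≤ sum g
sum-mono-≤ {zero}  f≤g = z≤n
sum-mono-≤ {suc n} f≤g = +-mono-≤ (f≤g zero) (sum-mono-≤ (f≤g ∘ suc))

-- First-moment principle. Every vertex that the proof picks, for a tuple `T` or as an image of a
-- vertex of `H`, is found through it.
sum<sum⇒∃< : ∀ {n} (f g : Fin n → ℕ) → sum f < sum g → ∃ λ i → f i < g i
sum<sum⇒∃< f g f<g with Fin.any? (λ i → f i <? g i)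
... | yes i,fi<gi = i,fi<gi
... | no  ∄i      = contradiction f<g (≤⇒≯ (sum-mono-≤ λ i → ≮⇒≥ λ fi<gi → ∄i (i , fi<gi)))

-- Subsets of the vertex set and their sizes.

Subset : ℕ → Set
Subset N = Fin N → Bool

infixr 7 _∩_
_∩_ : ∀ {N} → Subset N → Subset N → Subset N
(A ∩ B) w = A w ∧ B w

infix 4 _⊆_
_⊆_ : ∀ {N} → Subset N → Subset N → Set
A ⊆ B = ∀ w → A w ≡ true → B w ≡ true

⊆-all : ∀ {N} {A B : Subset N} → A ⊆ B → ∀ S → all A S ≡ true → all B S ≡ true
⊆-all A⊆B []      _   = refl
⊆-all A⊆B (w ∷ S) A∋S = let A∋w , A∋S′ = ∧-true⁻ A∋S in ∧-true⁺ (A⊆B w A∋w) (⊆-all A⊆B S A∋S′)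

all-++ : ∀ {N} (A : Subset N) S T → all A (S ++ T) ≡ all A S ∧ all A T
all-++ A []      T = refl
all-++ A (w ∷ S) T = trans (cong (A w ∧_) (all-++ A S T)) (sym (∧-assoc (A w) _ _))

∣_∣ : ∀ {N} → Subset N → ℕ
∣_∣ {N} A = ∑[ w < N ] 𝟙 (A w)

∣∣-cong : ∀ {N} {A B : Subset N} → (∀ w → A w ≡ B w) → ∣ A ∣ ≡ ∣ B ∣
∣∣-cong A≗B = sum-cong-≗ (cong 𝟙 ∘ A≗B)

∣∣-mono : ∀ {N} {A B : Subset N} → A ⊆ B → ∣ A ∣ ≤ ∣ B ∣
∣∣-mono {A = A} {B} A⊆B = sum-mono-≤ λ w → 𝟙-mono (A⊆B w)
  where
  𝟙-mono : ∀ {a b} → (a ≡ true → b ≡ true) → 𝟙 a ≤ 𝟙 b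
  𝟙-mono {false} a⇒b = z≤n
  𝟙-mono {true}  a⇒b = ≤-reflexive (sym (cong 𝟙 (a⇒b refl)))

full : ∀ {N} → Subset N
full _ = true

all-full : ∀ {N} (S : List (Fin N)) → all full S ≡ true
all-full []      = refl
all-full (_ ∷ S) = all-full S

∣full∣ : ∀ N → ∣ full {N} ∣ ≡ N
∣full∣ zero    = refl
∣full∣ (suc N) = cong suc (∣full∣ N)

-- Sum of F over the extensions of S by k vertices of A, the newest vertex in front.
extSum : ∀ {N} → Subset N → ℕ → (List (Fin N) → ℕ) → List (Fin N) → ℕ
extSum     A zero    F S = F S
extSum {N} A (suc k) F S = ∑[ w < N ] (𝟙 (A w) * extSum A k F (w ∷ S))

-- Rules for summing over tuples.

module _ {N : ℕ} where

  private
    V = Fin N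

  extSum-mono : ∀ {A : Subset N} {F G : List V → ℕ} → (∀ S → all A S ≡ true → F S ≤ G S) →
                ∀ k S → all A S ≡ true → extSum A k F S ≤ extSum A k G S
  extSum-mono         F≤G zero    S A∋S = F≤G S A∋S
  extSum-mono {A} {F} {G} F≤G (suc k) S A∋S = sum-mono-≤ λ w → step w (A w) refl
    where
    step : ∀ w b → A w ≡ b → 𝟙 b * extSum A k F (w ∷ S) ≤ 𝟙 b * extSum A k G (w ∷ S)
    step w false _   = z≤n
    step w true  A∋w = +-monoˡ-≤ 0 (extSum-mono F≤G k (w ∷ S) (∧-true⁺ A∋w A∋S))

  extSum-cong : ∀ (A : Subset N) {F G : List V → ℕ} → (∀ S → F S ≡ G S) →
                ∀ k S → extSum A k F S ≡ extSum A k G S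
  extSum-cong A F≗G zero    S = F≗G S
  extSum-cong A F≗G (suc k) S = sum-cong-≗ λ w → cong (𝟙 (A w) *_) (extSum-cong A F≗G k (w ∷ S))

  extSum-⊆ : ∀ {A B : Subset N} → A ⊆ B → ∀ F k S → extSum A k F S ≤ extSum B k F S
  extSum-⊆ A⊆B F zero    S = ≤-refl
  extSum-⊆ {A} {B} A⊆B F (suc k) S = sum-mono-≤ λ w → step w (A w) refl
    where
    step : ∀ w b → A w ≡ b → 𝟙 b * extSum A k F (w ∷ S) ≤ 𝟙 (B w) * extSum B k F (w ∷ S)
    step w false _   = z≤n
    step w true  A∋w rewrite A⊆B w A∋w = +-monoˡ-≤ 0 (extSum-⊆ A⊆B F k (w ∷ S))

  extSum-∑ : ∀ (A : Subset N) {n} (F : Fin n → List V → ℕ) k S →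
             extSum A k (λ T → ∑[ i < n ] F i T) S ≡ ∑[ i < n ] extSum A k (F i) S
  extSum-∑ A F zero    S = refl
  extSum-∑ A {n} F (suc k) S = begin
    ∑[ w < N ] (𝟙 (A w) * extSum A k (λ T → ∑[ i < n ] F i T) (w ∷ S))
      ≡⟨ sum-cong-≗ (λ w → trans (cong (𝟙 (A w) *_) (extSum-∑ A F k (w ∷ S)))
                                 (*-distribˡ-sum (𝟙 (A w)) (λ i → extSum A k (F i) (w ∷ S)))) ⟩
    ∑[ w < N ] ∑[ i < n ] (𝟙 (A w) * extSum A k (F i) (w ∷ S))
      ≡⟨ ∑-comm (λ w i → 𝟙 (A w) * extSum A k (F i) (w ∷ S)) ⟩
    ∑[ i < n ] ∑[ w < N ] (𝟙 (A w) * extSum A k (F i) (w ∷ S)) ∎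
    where open ≡-Reasoning

  extSum-+ : ∀ (A : Subset N) (F G : List V → ℕ) k S →
             extSum A k (λ T → F T + G T) S ≡ extSum A k F S + extSum A k G S
  extSum-+ A F G zero    S = refl
  extSum-+ A F G (suc k) S = trans
    (sum-cong-≗ λ w → trans (cong (𝟙 (A w) *_) (extSum-+ A F G k (w ∷ S)))
                            (*-distribˡ-+ (𝟙 (A w)) _ _))
    (∑-distrib-+ (λ w → 𝟙 (A w) * extSum A k F (w ∷ S)) (λ w → 𝟙 (A w) * extSum A k G (w ∷ S)))

  extSum-* : ∀ (A : Subset N) c (F : List V → ℕ) k S →
             extSum A k (λ T → c * F T) S ≡ c * extSum A k F S
  extSum-* A c F zero    S = refl
  extSum-* A c F (suc k) S = trans
    (sum-cong-≗ λ w → trans (cong (𝟙 (A w) *_) (extSum-* A c F k (w ∷ S)))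
                            (swap (𝟙 (A w)) c _))
    (sym (*-distribˡ-sum c (λ w → 𝟙 (A w) * extSum A k F (w ∷ S))))
    where
    swap : ∀ a b x → a * (b * x) ≡ b * (a * x)
    swap = solve-∀

  sum-𝟙-* : ∀ (A : Subset N) c → ∑[ w < N ] (𝟙 (A w) * c) ≡ ∣ A ∣ * c
  sum-𝟙-* A c = begin
    ∑[ w < N ] (𝟙 (A w) * c) ≡⟨ sum-cong-≗ (λ w → *-comm (𝟙 (A w)) c) ⟩
    ∑[ w < N ] (c * 𝟙 (A w)) ≡⟨ *-distribˡ-sum c (𝟙 ∘ A) ⟨
    c * ∣ A ∣                ≡⟨ *-comm c ∣ A ∣ ⟩
    ∣ A ∣ * c                ∎
    where open ≡-Reasoning

  -- Each new vertex is constrained independently of the others, hence a pure power.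
  extSum-all : ∀ (A p : Subset N) k S →
               extSum A k (λ T → 𝟙 (all p T)) S ≡ ∣ A ∩ p ∣ ^ k * 𝟙 (all p S)
  extSum-all A p zero    S = sym (+-identityʳ _)
  extSum-all A p (suc k) S = begin
    ∑[ w < N ] (𝟙 (A w) * extSum A k (λ T → 𝟙 (all p T)) (w ∷ S))
      ≡⟨ sum-cong-≗ (λ w → trans (cong (𝟙 (A w) *_) (extSum-all A p k (w ∷ S))) (step w)) ⟩
    ∑[ w < N ] (𝟙 ((A ∩ p) w) * (∣ A ∩ p ∣ ^ k * 𝟙 (all p S)))
      ≡⟨ sum-𝟙-* (A ∩ p) _ ⟩
    ∣ A ∩ p ∣ * (∣ A ∩ p ∣ ^ k * 𝟙 (all p S))
      ≡⟨ *-assoc ∣ A ∩ p ∣ _ _ ⟨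
    ∣ A ∩ p ∣ ^ suc k * 𝟙 (all p S) ∎
    where
    open ≡-Reasoning
    shuffle : ∀ a c b s → a * (c * (b * s)) ≡ a * b * (c * s)
    shuffle = solve-∀
    step : ∀ w → 𝟙 (A w) * (∣ A ∩ p ∣ ^ k * 𝟙 (p w ∧ all p S))
               ≡ 𝟙 ((A ∩ p) w) * (∣ A ∩ p ∣ ^ k * 𝟙 (all p S))
    step w rewrite 𝟙-∧ (p w) (all p S) | 𝟙-∧ (A w) (p w) =
      shuffle (𝟙 (A w)) (∣ A ∩ p ∣ ^ k) (𝟙 (p w)) (𝟙 (all p S))

  extSum-const : ∀ (A : Subset N) c k S → extSum A k (λ _ → c) S ≡ ∣ A ∣ ^ k * c
  extSum-const A c zero    S = sym (+-identityʳ c)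
  extSum-const A c (suc k) S = begin
    ∑[ w < N ] (𝟙 (A w) * extSum A k (λ _ → c) (w ∷ S))
      ≡⟨ sum-cong-≗ (λ w → cong (𝟙 (A w) *_) (extSum-const A c k (w ∷ S))) ⟩
    ∑[ w < N ] (𝟙 (A w) * (∣ A ∣ ^ k * c)) ≡⟨ sum-𝟙-* A _ ⟩
    ∣ A ∣ * (∣ A ∣ ^ k * c)                ≡⟨ *-assoc ∣ A ∣ _ _ ⟨
    ∣ A ∣ ^ suc k * c                      ∎
    where open ≡-Reasoning

  -- Together with `extSum-++`, this splits a long tuple into a chosen tail `T` and a rest `S` in
  -- front of it, which is how long tuples absorb later choices.
  extSum-extSum : ∀ (A : Subset N) F j k S → extSum A j (extSum A k F) S ≡ extSum A (j + k) F S
  extSum-extSum A F zero    k S = refl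
  extSum-extSum A F (suc j) k S = sum-cong-≗ λ w → cong (𝟙 (A w) *_) (extSum-extSum A F j k (w ∷ S))

  extSum-++ : ∀ (A : Subset N) F T k S → extSum A k (λ R → F (R ++ T)) S ≡ extSum A k F (S ++ T)
  extSum-++ A F T zero    S = refl
  extSum-++ A F T (suc k) S = sum-cong-≗ λ w → cong (𝟙 (A w) *_) (extSum-++ A F T k (w ∷ S))

  -- The double count behind `bad-average`: once the tested tuple `S` is fixed first, the choices of
  -- `T` are easy to count.
  extSum-swap : ∀ (A B : Subset N) (F : List V → List V → ℕ) j k T₀ S₀ →
                extSum A j (λ T → extSum B k (F T) S₀) T₀
              ≡ extSum B k (λ S → extSum A j (λ T → F T S) T₀) S₀
  extSum-swap A B F j zero    T₀ S₀ = refl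
  extSum-swap A B F j (suc k) T₀ S₀ = begin
    extSum A j (λ T → ∑[ w < N ] (𝟙 (B w) * extSum B k (F T) (w ∷ S₀))) T₀
      ≡⟨ extSum-∑ A (λ w T → 𝟙 (B w) * extSum B k (F T) (w ∷ S₀)) j T₀ ⟩
    ∑[ w < N ] extSum A j (λ T → 𝟙 (B w) * extSum B k (F T) (w ∷ S₀)) T₀
      ≡⟨ sum-cong-≗ (λ w → trans (extSum-* A (𝟙 (B w)) (λ T → extSum B k (F T) (w ∷ S₀)) j T₀)
                                 (cong (𝟙 (B w) *_) (extSum-swap A B F j k T₀ (w ∷ S₀)))) ⟩
    ∑[ w < N ] (𝟙 (B w) * extSum B k (λ S → extSum A j (λ T → F T S) T₀) (w ∷ S₀)) ∎
    where open ≡-Reasoning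

  extSum≤⇒∃≤ : ∀ (A : Subset N) F G → 0 < ∣ A ∣ → ∀ k S → all A S ≡ true →
               extSum A k F S ≤ extSum A k G S → ∃ λ T → all A T ≡ true × F T ≤ G T
  extSum≤⇒∃≤ A F G 0<∣A∣ zero    S A∋S F≤G = S , A∋S , F≤G
  extSum≤⇒∃≤ A F G 0<∣A∣ (suc k) S A∋S F≤G =
    -- One extra unit for each vertex of the nonempty `A` makes the comparison strict. The
    -- inequality found cannot hold outside `A`, where both sides vanish, and inside `A` it gives
    -- back `≤`.
    let w , f<g+1 = sum<sum⇒∃< (λ w → 𝟙 (A w) * f w) (λ w → 𝟙 (A w) * g w + 𝟙 (A w))
                      (≤-<-trans F≤G (subst (sum (λ w → 𝟙 (A w) * g w) <_)
                        (sym (∑-distrib-+ (λ w → 𝟙 (A w) * g w) (𝟙 ∘ A)))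
                        (m<m+n _ 0<∣A∣)))
    in step w (A w) refl f<g+1
    where
    f g : V → ℕ
    f w = extSum A k F (w ∷ S)
    g w = extSum A k G (w ∷ S)
    step : ∀ w b → A w ≡ b → 𝟙 b * f w < 𝟙 b * g w + 𝟙 b → ∃ λ T → all A T ≡ true × F T ≤ G T
    step w true A∋w f<g+1 rewrite +-identityʳ (f w) | +-identityʳ (g w) | +-comm (g w) 1 =
      extSum≤⇒∃≤ A F G 0<∣A∣ k (w ∷ S) (∧-true⁺ A∋w A∋S) (m<1+n⇒m≤n f<g+1)

-- Lists: pairwise relations and images of selected indices.

module _ {A : Set} {R : A → A → Set} where

  lookup-AllPairs : (∀ {x y} → R x y → R y x) → ∀ {xs} → AllPairs R xs →
                    ∀ i j → i ≢ j → R (lookup xs i) (lookup xs j)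
  lookup-AllPairs R-sym (_   ∷ _)   zero    zero    i≢j = contradiction refl i≢j
  lookup-AllPairs R-sym (Rxs ∷ _)   zero    (suc j) _   = All.lookup Rxs (∈-lookup j)
  lookup-AllPairs R-sym (Rxs ∷ _)   (suc i) zero    _   = R-sym (All.lookup Rxs (∈-lookup i))
  lookup-AllPairs R-sym (_   ∷ Rs)  (suc i) (suc j) i≢j = lookup-AllPairs R-sym Rs i j (i≢j ∘ cong suc)

-- Images of the selected indices, largest index first, so that placing one more
-- vertex of H conses its image.
imgs : ∀ {A : Set} {n} → Vec Bool n → (Fin n → A) → List A
imgs []           g = []
imgs (true  ∷ bs) g = imgs bs (g ∘ suc) ++ g zero ∷ []
imgs (false ∷ bs) g = imgs bs (g ∘ suc)

module _ {A : Set} where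

  imgs-none : ∀ {n} (g : Fin n → A) → imgs (tabulate (const false)) g ≡ []
  imgs-none {zero}  g = refl
  imgs-none {suc n} g = imgs-none (g ∘ suc)

  -- Indices above `i` are cut off on both sides, so only the value at `i` matters; being the
  -- largest index left, it lands in front.
  imgs-updateAt : ∀ {n} (p : Fin n → Bool) i w (g : Fin n → A) →
    imgs (tabulate (λ a → (toℕ a <ᵇ suc (toℕ i)) ∧ p a)) (updateAt g i (const w))
    ≡ (if p i then w ∷_ else id) (imgs (tabulate (λ a → (toℕ a <ᵇ toℕ i) ∧ p a)) g)
  imgs-updateAt p zero w g with p zero
  ... | true  = trans (cong (_++ w ∷ []) (imgs-none (g ∘ suc))) (cong (w ∷_) (sym (imgs-none (g ∘ suc))))
  ... | false = refl
  imgs-updateAt p (suc i) w g with p zero | imgs-updateAt (p ∘ suc) i w (g ∘ suc)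
  ... | false | ih = ih
  ... | true  | ih with p (suc i)
  ...   | true  = cong (_++ g zero ∷ []) ih
  ...   | false = cong (_++ g zero ∷ []) ih

  -- The general `h` is for the induction: `allFin` is a tabulation whose tail tabulates another
  -- function.
  length-imgs : ∀ {m n} (p : Fin m → Bool) (p′ : Fin n → Bool) (h : Fin m → Fin n) (g : Fin m → A) →
                (∀ a → p a ≡ true → p′ (h a) ≡ true) →
                length (imgs (tabulate p) g) ≤ length (filterᵇ p′ (List.tabulate h))
  length-imgs {zero}  p p′ h g p⇒p′ = z≤n
  length-imgs {suc m} p p′ h g p⇒p′
    with p zero | p′ (h zero) | p⇒p′ zero | length-imgs (p ∘ suc) p′ (h ∘ suc) (g ∘ suc) (p⇒p′ ∘ suc)
  ... | true  | true  | _  | ih = ≤-trans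
        (≤-reflexive (trans (length-++ (imgs (tabulate (p ∘ suc)) (g ∘ suc))) (+-comm _ 1))) (s≤s ih)
  ... | true  | false | p₀ | ih = contradiction (p₀ refl) λ ()
  ... | false | true  | _  | ih = m≤n⇒m≤1+n ih
  ... | false | false | _  | ih = ih

module _ {N : ℕ} (A : Subset N) where

  all-imgs⁺ : ∀ {n} (p : Fin n → Bool) (g : Fin n → Fin N) → (∀ a → p a ≡ true → A (g a) ≡ true) →
              all A (imgs (tabulate p) g) ≡ true
  all-imgs⁺ {zero}  p g A∋ = refl
  all-imgs⁺ {suc n} p g A∋ with p zero | A∋ zero
  ... | false | _   = all-imgs⁺ (p ∘ suc) (g ∘ suc) (A∋ ∘ suc)
  ... | true  | A∋₀ = trans (all-++ A (imgs (tabulate (p ∘ suc)) (g ∘ suc)) (g zero ∷ []))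
                            (∧-true⁺ (all-imgs⁺ (p ∘ suc) (g ∘ suc) (A∋ ∘ suc)) (∧-true⁺ (A∋₀ refl) refl))

  all-∷ʳ⁻ : ∀ S {w} → all A (S ++ w ∷ []) ≡ true → all A S ≡ true × A w ≡ true
  all-∷ʳ⁻ S {w} A∋ = let A∋S , A∋w = ∧-true⁻ {all A S} (trans (sym (all-++ A S (w ∷ []))) A∋)
                     in A∋S , proj₁ (∧-true⁻ {A w} A∋w)

  all-imgs⁻ : ∀ {n} (p : Fin n → Bool) (g : Fin n → Fin N) → all A (imgs (tabulate p) g) ≡ true →
              ∀ a → p a ≡ true → A (g a) ≡ true
  all-imgs⁻ {suc n} p g A∋ a pa with p zero in eq
  all-imgs⁻ {suc n} p g A∋ zero    pa | false = contradiction (trans (sym pa) eq) λ ()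
  all-imgs⁻ {suc n} p g A∋ (suc a) pa | false = all-imgs⁻ (p ∘ suc) (g ∘ suc) A∋ a pa
  all-imgs⁻ {suc n} p g A∋ a       pa | true with all-∷ʳ⁻ (imgs (tabulate (p ∘ suc)) (g ∘ suc)) A∋
  all-imgs⁻ {suc n} p g A∋ zero    pa | true | _    , A∋₀ = A∋₀
  all-imgs⁻ {suc n} p g A∋ (suc a) pa | true | A∋ₛ , _    = all-imgs⁻ (p ∘ suc) (g ∘ suc) A∋ₛ a pa

-- Counting tools for the union bound, and roundings.

∑-𝟙-≟ : ∀ {N} (v : Fin N) → ∑[ w < N ] 𝟙 (does (v Fin.≟ w)) ≡ 1
∑-𝟙-≟ {suc N} zero    = cong suc (sum-replicate-zero N)
∑-𝟙-≟ {suc N} (suc v) = ∑-𝟙-≟ v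

term≤sum : ∀ {n} (f : Fin n → ℕ) i → f i ≤ sum f
term≤sum f zero    = m≤m+n _ _
term≤sum f (suc i) = ≤-trans (term≤sum (f ∘ suc) i) (m≤n+m _ _)

module _ {A : Set} where

  term≤sumᴸ : ∀ (f : A → ℕ) {x xs} → x ∈ xs → f x ≤ sumᴸ (map f xs)
  term≤sumᴸ f (here refl) = m≤m+n _ _
  term≤sumᴸ f {xs = y ∷ _} (there x∈xs) = ≤-trans (term≤sumᴸ f x∈xs) (m≤n+m _ (f y))

  ∑-sumᴸ : ∀ {N} (f : A → Fin N → ℕ) xs →
           ∑[ w < N ] sumᴸ (map (λ x → f x w) xs) ≡ sumᴸ (map (λ x → ∑[ w < N ] f x w) xs)
  ∑-sumᴸ {N} f []   = sum-replicate-zero N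
  ∑-sumᴸ f (x ∷ xs) = trans (∑-distrib-+ (f x) (λ w → sumᴸ (map (λ x → f x w) xs))) (cong (sum (f x) +_) (∑-sumᴸ f xs))

  sumᴸ-*-≤ : ∀ (f : A → ℕ) L n {xs} → All (λ x → f x * L ≤ n) xs → sumᴸ (map f xs) * L ≤ length xs * n
  sumᴸ-*-≤ f L n []                  = z≤n
  sumᴸ-*-≤ f L n {x ∷ xs} (fx≤ ∷ f≤) = ≤-trans (≤-reflexive (*-distribʳ-+ L (f x) _)) (+-mono-≤ fx≤ (sumᴸ-*-≤ f L n f≤))

-- `2 ^ suc ℓ` becomes the bound `L` above `Δ`, while `2 ^ ℓ ≤ Δ` brings `Δ` back into the final
-- estimate.
binary-log : ∀ Δ → 1 ≤ Δ → ∃ λ ℓ → 2 ^ ℓ ≤ Δ × Δ < 2 ^ suc ℓ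
binary-log (suc zero)      _ = 0 , ≤-refl , ≤-refl
binary-log (suc Δ@(suc _)) _ with binary-log Δ (s≤s z≤n)
... | ℓ , lo , hi with m≤n⇒m<n∨m≡n hi
...   | inj₁ Δ+1<2^ = ℓ , m≤n⇒m≤1+n lo , Δ+1<2^
...   | inj₂ Δ+1≡2^ = suc ℓ , ≤-reflexive (sym Δ+1≡2^) ,
                      subst (_< 2 ^ suc (suc ℓ)) (sym Δ+1≡2^) (^-monoʳ-< 2 ≤-refl (n<1+n (suc ℓ)))

m<[1+m/n]*n : ∀ m n .{{_ : NonZero n}} → m < suc (m / n) * n
m<[1+m/n]*n m n = begin-strict
  m                      ≡⟨ m≡m%n+[m/n]*n m n ⟩
  m % n + m / n * n      <⟨ +-monoˡ-< (m / n * n) (m%n<n m n) ⟩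
  n + m / n * n          ∎
  where open ≤-Reasoning

-- The construction costs an exponent of order `q * q`; this trades one factor `q` for the `3 ^ q`
-- of the statement.
n≤3^n : ∀ n → n ≤ 3 ^ n
n≤3^n zero    = z≤n
n≤3^n (suc n) = begin
  1 + n                  ≤⟨ +-mono-≤ (m^n>0 3 n) (n≤3^n n) ⟩
  3 ^ n + 3 ^ n          ≤⟨ +-monoʳ-≤ (3 ^ n) (m≤m+n (3 ^ n) _) ⟩
  3 ^ suc n              ∎
  where open ≤-Reasoning

-- Iterated dependent random choice

module Monochromatic {N : ℕ} (χ : Colouring N) where

  private
    V = Fin N

  -- The diagonal is included, so a vertex may count as its own neighbour. This keeps `degree-sum`
  -- exact; distinctness of images is enforced in the embedding.
  hit : Bool → V → Subset N
  hit c z w = does (col χ z w ≟ c)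

  hit-sym : ∀ c z w → hit c z w ≡ hit c w z
  hit-sym c z w = cong (λ b → does (b ≟ c)) (colSym χ z w)

  nbhd : Bool → List V → Subset N
  nbhd c S w = all (hit c w) S

  -- Both sides say that all pairs between `S` and `T` have colour `c`.
  nbhd-swap : ∀ c S T → all (nbhd c T) S ≡ all (nbhd c S) T
  nbhd-swap c []      T = sym (all-full T)
  nbhd-swap c (w ∷ S) T = trans (cong (nbhd c T w ∧_) (nbhd-swap c S T)) (split T)
    where
    interchange : ∀ a b c d → (a ∧ b) ∧ (c ∧ d) ≡ (a ∧ c) ∧ (b ∧ d)
    interchange false b c     d = refl
    interchange true  b true  d = refl
    interchange true  b false d = ∧-comm b false
    split : ∀ T → all (hit c w) T ∧ all (nbhd c S) T ≡ all (nbhd c (w ∷ S)) T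
    split []      = refl
    split (z ∷ T) = trans (interchange (hit c w z) _ _ _) (cong₂ (λ a b → (a ∧ nbhd c S z) ∧ b) (hit-sym c w z) (split T))

  -- A step choosing T from A has Z = N_c(T); B starts as A and is cut down to the
  -- common c-neighbours of every tuple chosen later.
  record Stage : Set where
    constructor stage
    field
      colour : Bool
      Z B    : Subset N
  open Stage

  -- Only tuples inside `Z` are tested: the images of the earlier neighbours of a vertex lie in
  -- blocks contained in its `Z`.
  bad : ℕ → Stage → List V → ℕ
  bad m st S = 𝟙 (all (Z st) S ∧ (∣ B st ∩ nbhd (colour st) S ∣ <ᵇ m))

  badTotal : ℕ → List Stage → List V → ℕ
  badTotal m sts S = sumᴸ (map (λ st → bad m st S) sts)

  restrict : List V → Stage → Stage
  restrict T st = stage (colour st) (Z st) (B st ∩ nbhd (colour st) T)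

  -- Common neighbours of `S` inside `B ∩ N(T)` are common neighbours of `S ++ T` inside `B`, so
  -- restricting is the same as testing a longer tuple.
  bad-restrict : ∀ m st T S → all (Z st) T ≡ true → bad m (restrict T st) S ≡ bad m st (S ++ T)
  bad-restrict m st T S Z∋T =
    cong₂ (λ a k → 𝟙 (a ∧ (k <ᵇ m)))
      (sym (trans (all-++ (Z st) S T) (trans (cong (all (Z st) S ∧_) Z∋T) (∧-identityʳ _))))
      (∣∣-cong λ w → trans (∧-assoc (B st w) _ _)
        (cong (B st w ∧_) (trans (∧-comm (nbhd (colour st) T w) _) (sym (all-++ (hit (colour st) w) S T)))))

  badTotal-restrict : ∀ m sts T S → All (λ st → all (Z st) T ≡ true) sts →
                      badTotal m (map (restrict T) sts) S ≡ badTotal m sts (S ++ T)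
  badTotal-restrict m []         T S []           = refl
  badTotal-restrict m (st ∷ sts) T S (Z∋T ∷ Z∋Ts) =
    cong₂ _+_ (bad-restrict m st T S Z∋T) (badTotal-restrict m sts T S Z∋Ts)

  -- One step: averaging over the tuple `T`.

  degree-sum : ∀ (A : Subset N) w → ∣ A ∩ hit true w ∣ + ∣ A ∩ hit false w ∣ ≡ ∣ A ∣
  degree-sum A w = trans (sym (∑-distrib-+ (𝟙 ∘ (A ∩ hit true w)) (𝟙 ∘ (A ∩ hit false w))))
                         (sum-cong-≗ λ z → split (A z) (col χ w z))
    where
    split : ∀ a b → 𝟙 (a ∧ does (b ≟ true)) + 𝟙 (a ∧ does (b ≟ false)) ≡ 𝟙 a
    split false b     = refl
    split true  false = refl
    split true  true  = refl

  -- Crude convexity: the larger summand is at least half of the sum.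
  powers-of-summands : ∀ a b t → (a + b) ^ t ≤ 2 ^ t * (a ^ t + b ^ t)
  powers-of-summands a b t with ≤-total a b
  ... | inj₁ a≤b = begin
    (a + b) ^ t             ≤⟨ ^-monoˡ-≤ t (+-mono-≤ a≤b (≤-reflexive (sym (+-identityʳ b)))) ⟩
    (2 * b) ^ t             ≡⟨ ^-distribʳ-* t 2 b ⟩
    2 ^ t * b ^ t           ≤⟨ *-monoʳ-≤ (2 ^ t) (m≤n+m (b ^ t) (a ^ t)) ⟩
    2 ^ t * (a ^ t + b ^ t) ∎
    where open ≤-Reasoning
  ... | inj₂ b≤a = begin
    (a + b) ^ t             ≤⟨ ^-monoˡ-≤ t (+-monoʳ-≤ a (≤-trans b≤a (≤-reflexive (sym (+-identityʳ a))))) ⟩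
    (2 * a) ^ t             ≡⟨ ^-distribʳ-* t 2 a ⟩
    2 ^ t * a ^ t           ≤⟨ *-monoʳ-≤ (2 ^ t) (m≤m+n (a ^ t) (b ^ t)) ⟩
    2 ^ t * (a ^ t + b ^ t) ∎
    where open ≤-Reasoning

  commonNbrs : Subset N → Bool → List V → ℕ
  commonNbrs A c T = ∣ A ∩ nbhd c T ∣

  -- Double counting: `w` is a common neighbour of exactly those tuples that lie in its own
  -- neighbourhood.
  extSum-commonNbrs : ∀ A c t → extSum A t (commonNbrs A c) [] ≡ ∑[ w < N ] (𝟙 (A w) * ∣ A ∩ hit c w ∣ ^ t)
  extSum-commonNbrs A c t = begin
    extSum A t (λ T → ∑[ w < N ] 𝟙 (A w ∧ nbhd c T w)) []
      ≡⟨ extSum-∑ A (λ w T → 𝟙 (A w ∧ nbhd c T w)) t [] ⟩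
    ∑[ w < N ] extSum A t (λ T → 𝟙 (A w ∧ nbhd c T w)) []
      ≡⟨ sum-cong-≗ (λ w → trans (extSum-cong A (λ T → 𝟙-∧ (A w) (nbhd c T w)) t [])
           (trans (extSum-* A (𝟙 (A w)) (λ T → 𝟙 (all (hit c w) T)) t [])
             (cong (𝟙 (A w) *_) (trans (extSum-all A (hit c w) t []) (*-identityʳ _))))) ⟩
    ∑[ w < N ] (𝟙 (A w) * ∣ A ∩ hit c w ∣ ^ t) ∎
    where open ≡-Reasoning

  -- The two colour degrees of each `w` add up to the size of `A`, so both colours together
  -- contribute at least `∣ A ∣ ^ suc t / 2 ^ t`, and the better one half of that. An average tuple
  -- thus keeps at least a `1 / 2 ^ suc t` fraction of `A`.
  majority-colour : ∀ A t → ∃ λ c → ∣ A ∣ ^ suc t ≤ 2 ^ suc t * extSum A t (commonNbrs A c) []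
  majority-colour A t = choose (≤-total (E false) (E true))
    where
    E : Bool → ℕ
    E c = extSum A t (commonNbrs A c) []
    both : ∣ A ∣ ^ suc t ≤ 2 ^ t * (E true + E false)
    both = begin
      ∣ A ∣ * ∣ A ∣ ^ t                     ≡⟨ sum-𝟙-* A (∣ A ∣ ^ t) ⟨
      ∑[ w < N ] (𝟙 (A w) * ∣ A ∣ ^ t)      ≤⟨ sum-mono-≤ (λ w → *-monoʳ-≤ (𝟙 (A w)) (pointwise w)) ⟩
      ∑[ w < N ] (𝟙 (A w) * (2 ^ t * (d true w + d false w)))
        ≡⟨ sum-cong-≗ (λ w → expand (𝟙 (A w)) (2 ^ t) (d true w) (d false w)) ⟩
      ∑[ w < N ] (2 ^ t * (𝟙 (A w) * d true w + 𝟙 (A w) * d false w))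
        ≡⟨ *-distribˡ-sum (2 ^ t) (λ w → 𝟙 (A w) * d true w + 𝟙 (A w) * d false w) ⟨
      2 ^ t * ∑[ w < N ] (𝟙 (A w) * d true w + 𝟙 (A w) * d false w)
        ≡⟨ cong (2 ^ t *_) (∑-distrib-+ (λ w → 𝟙 (A w) * d true w) (λ w → 𝟙 (A w) * d false w)) ⟩
      2 ^ t * (∑[ w < N ] (𝟙 (A w) * d true w) + ∑[ w < N ] (𝟙 (A w) * d false w))
        ≡⟨ cong (2 ^ t *_) (cong₂ _+_ (extSum-commonNbrs A true t) (extSum-commonNbrs A false t)) ⟨
      2 ^ t * (E true + E false)            ∎
      where
      open ≤-Reasoning
      d : Bool → V → ℕ
      d c w = ∣ A ∩ hit c w ∣ ^ t
      pointwise : ∀ w → ∣ A ∣ ^ t ≤ 2 ^ t * (d true w + d false w)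
      pointwise w = subst (λ a → a ^ t ≤ 2 ^ t * (d true w + d false w)) (degree-sum A w)
                          (powers-of-summands ∣ A ∩ hit true w ∣ ∣ A ∩ hit false w ∣ t)
      expand : ∀ a p x y → a * (p * (x + y)) ≡ p * (a * x + a * y)
      expand = solve-∀
    double : ∀ p e → p * (e + e) ≡ 2 * p * e
    double = solve-∀
    choose : E false ≤ E true ⊎ E true ≤ E false → ∃ λ c → ∣ A ∣ ^ suc t ≤ 2 ^ suc t * E c
    choose (inj₁ f≤t) = true  , (begin
      ∣ A ∣ ^ suc t              ≤⟨ both ⟩
      2 ^ t * (E true + E false) ≤⟨ *-monoʳ-≤ (2 ^ t) (+-monoʳ-≤ (E true) f≤t) ⟩
      2 ^ t * (E true + E true)  ≡⟨ double (2 ^ t) (E true) ⟩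
      2 ^ suc t * E true         ∎)
      where open ≤-Reasoning
    choose (inj₂ t≤f) = false , (begin
      ∣ A ∣ ^ suc t               ≤⟨ both ⟩
      2 ^ t * (E true + E false)  ≤⟨ *-monoʳ-≤ (2 ^ t) (+-monoˡ-≤ (E false) t≤f) ⟩
      2 ^ t * (E false + E false) ≡⟨ double (2 ^ t) (E false) ⟩
      2 ^ suc t * E false         ∎)
      where open ≤-Reasoning

  -- If `S` has `k < m` common neighbours in `A`, it is bad only for tuples `T` drawn from these,
  -- and there are `k ^ t` of them.
  bad-average : ∀ A c t D m →
    extSum A t (λ T → extSum full D (bad m (stage c (nbhd c T) A)) []) [] ≤ N ^ D * m ^ t
  bad-average A c t D m = begin
    extSum A t (λ T → extSum full D (bad m (stage c (nbhd c T) A)) []) []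
      ≡⟨ extSum-swap A full (λ T → bad m (stage c (nbhd c T) A)) t D [] [] ⟩
    extSum full D (λ S → extSum A t (λ T → bad m (stage c (nbhd c T) A) S) []) []
      ≤⟨ extSum-mono (λ S _ → pointwise S) D [] refl ⟩
    extSum full D (λ _ → m ^ t) []
      ≡⟨ extSum-const full (m ^ t) D [] ⟩
    ∣ full {N} ∣ ^ D * m ^ t
      ≡⟨ cong (λ a → a ^ D * m ^ t) (∣full∣ N) ⟩
    N ^ D * m ^ t ∎
    where
    open ≤-Reasoning
    few^ : ∀ k → 𝟙 (k <ᵇ m) * k ^ t ≤ m ^ t
    few^ k with k <ᵇ m in eq
    ... | false = z≤n
    ... | true  = ≤-trans (≤-reflexive (+-identityʳ _)) (^-monoˡ-≤ t (<⇒≤ (<ᵇ⇒< k m (Equivalence.from T-≡ eq))))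
    pointwise : ∀ S → extSum A t (λ T → bad m (stage c (nbhd c T) A) S) [] ≤ m ^ t
    pointwise S = begin
      extSum A t (λ T → 𝟙 (all (nbhd c T) S ∧ (k <ᵇ m))) []
        ≡⟨ extSum-cong A (λ T → trans (cong 𝟙 (∧-comm (all (nbhd c T) S) (k <ᵇ m)))
                           (trans (𝟙-∧ (k <ᵇ m) _) (cong (λ b → 𝟙 (k <ᵇ m) * 𝟙 b) (nbhd-swap c S T)))) t [] ⟩
      extSum A t (λ T → 𝟙 (k <ᵇ m) * 𝟙 (all (nbhd c S) T)) []
        ≡⟨ extSum-* A (𝟙 (k <ᵇ m)) (λ T → 𝟙 (all (nbhd c S) T)) t [] ⟩
      𝟙 (k <ᵇ m) * extSum A t (λ T → 𝟙 (all (nbhd c S) T)) []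
        ≡⟨ cong (𝟙 (k <ᵇ m) *_) (trans (extSum-all A (nbhd c S) t []) (*-identityʳ _)) ⟩
      𝟙 (k <ᵇ m) * k ^ t
        ≤⟨ few^ k ⟩
      m ^ t ∎
      where
      k = ∣ A ∩ nbhd c S ∣

  newStages : Subset N → Bool → List V → List Stage → List Stage
  newStages A c T sts = stage c (nbhd c T) A ∷ map (restrict T) sts

  -- A `D`-tuple `S` bad for an old stage after restriction to `T` is a `(t + D)`-tuple `S ++ T` bad
  -- before it; `A ⊆ Z` puts `T` inside `Z`. Only the new stage adds a term.
  badTotal-average : ∀ A c t D m sts → All (λ st → A ⊆ Z st) sts →
    extSum A t (λ T → extSum full D (badTotal m (newStages A c T sts)) []) []
      ≤ extSum full (t + D) (badTotal m sts) [] + N ^ D * m ^ t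
  badTotal-average A c t D m sts A⊆Z = begin
    extSum A t (λ T → extSum full D (badTotal m (newStages A c T sts)) []) []
      ≡⟨ extSum-cong A (λ T → extSum-+ full (bad m (stage c (nbhd c T) A)) (badTotal m (map (restrict T) sts)) D []) t [] ⟩
    extSum A t (λ T → new T + old T) []
      ≡⟨ extSum-+ A new old t [] ⟩
    extSum A t new [] + extSum A t old []
      ≤⟨ +-mono-≤ (bad-average A c t D m) old-average ⟩
    N ^ D * m ^ t + extSum full (t + D) (badTotal m sts) []
      ≡⟨ +-comm (N ^ D * m ^ t) _ ⟩
    extSum full (t + D) (badTotal m sts) [] + N ^ D * m ^ t ∎
    where
    open ≤-Reasoning
    new old : List V → ℕ
    new T = extSum full D (bad m (stage c (nbhd c T) A)) []
    old T = extSum full D (badTotal m (map (restrict T) sts)) []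
    old-average : extSum A t old [] ≤ extSum full (t + D) (badTotal m sts) []
    old-average = begin
      extSum A t old []
        ≤⟨ extSum-mono (λ T A∋T → ≤-reflexive (trans
             (extSum-cong full (λ S → badTotal-restrict m sts T S (All.map (λ A⊆Z → ⊆-all A⊆Z T A∋T) A⊆Z)) D [])
             (extSum-++ full (badTotal m sts) T D []))) t [] refl ⟩
      extSum A t (extSum full D (badTotal m sts)) []
        ≤⟨ extSum-⊆ (λ _ _ → refl) (extSum full D (badTotal m sts)) t [] ⟩
      extSum full t (extSum full D (badTotal m sts)) []
        ≡⟨ extSum-extSum full (badTotal m sts) t D [] ⟩
      extSum full (t + D) (badTotal m sts) [] ∎

  -- `T` must serve size and badness at once, so both averages are merged into one inequality. Each
  -- of the two terms of `F` sums to at most `a ^ suc t * Q`; together they double the factor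
  -- `2 ^ suc t` of `majority-colour`.
  dependent-random-choice : ∀ A t D m sts → 0 < ∣ A ∣ → 0 < N → 0 < m → All (λ st → A ⊆ Z st) sts →
    ∃₂ λ c T → all A T ≡ true
      × ∣ A ∣ ≤ 2 ^ (2 + t) * ∣ A ∩ nbhd c T ∣
      × ∣ A ∣ ^ t * extSum full D (badTotal m (newStages A c T sts)) []
          ≤ 2 ^ (2 + t) * (extSum full (t + D) (badTotal m sts) [] + N ^ D * m ^ t)
  dependent-random-choice A t D m sts 0<a 0<N 0<m A⊆Z =
    let c , majority = majority-colour A t
        T , A∋T , F≤G = extSum≤⇒∃≤ A (F c) (G c) 0<a t [] refl (average c majority)
    in c , T , A∋T , size c T F≤G , badness c T F≤G
    where
    open ≤-Reasoning
    a Q : ℕ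
    a = ∣ A ∣
    Q = extSum full (t + D) (badTotal m sts) [] + N ^ D * m ^ t
    instance
      a≢0 : NonZero a
      a≢0 = >-nonZero 0<a
      N≢0 : NonZero N
      N≢0 = >-nonZero 0<N
      m≢0 : NonZero m
      m≢0 = >-nonZero 0<m
      Q≢0 : NonZero Q
      Q≢0 = >-nonZero (≤-trans (*-mono-≤ (m^n>0 N D) (m^n>0 m t)) (m≤n+m _ _))
    Ψ : Bool → List V → ℕ
    Ψ c T = extSum full D (badTotal m (newStages A c T sts)) []
    -- F c T ≤ G c T bounds the size of A ∩ N_c(T) from below and Ψ c T from above at once.
    F G : Bool → List V → ℕ
    F c T = a * Q + a ^ suc t * Ψ c T
    G c T = 2 ^ (2 + t) * Q * commonNbrs A c T
    average : ∀ c → a ^ suc t ≤ 2 ^ suc t * extSum A t (commonNbrs A c) [] → extSum A t (F c) [] ≤ extSum A t (G c) []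
    average c majority = begin
      extSum A t (F c) []
        ≡⟨ extSum-+ A (λ _ → a * Q) (λ T → a ^ suc t * Ψ c T) t [] ⟩
      extSum A t (λ _ → a * Q) [] + extSum A t (λ T → a ^ suc t * Ψ c T) []
        ≡⟨ cong₂ _+_ (extSum-const A (a * Q) t []) (extSum-* A (a ^ suc t) (Ψ c) t []) ⟩
      a ^ t * (a * Q) + a ^ suc t * extSum A t (Ψ c) []
        ≤⟨ +-monoʳ-≤ (a ^ t * (a * Q)) (*-monoʳ-≤ (a ^ suc t) (badTotal-average A c t D m sts A⊆Z)) ⟩
      a ^ t * (a * Q) + a ^ suc t * Q
        ≡⟨ double (a ^ t) a Q ⟩
      2 * Q * a ^ suc t
        ≤⟨ *-monoʳ-≤ (2 * Q) majority ⟩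
      2 * Q * (2 ^ suc t * extSum A t (commonNbrs A c) [])
        ≡⟨ regroup Q (2 ^ suc t) _ ⟩
      2 ^ (2 + t) * Q * extSum A t (commonNbrs A c) []
        ≡⟨ extSum-* A (2 ^ (2 + t) * Q) (commonNbrs A c) t [] ⟨
      extSum A t (G c) [] ∎
      where
      double : ∀ p a q → p * (a * q) + a * p * q ≡ 2 * q * (a * p)
      double = solve-∀
      regroup : ∀ q p e → 2 * q * (p * e) ≡ 2 * p * q * e
      regroup = solve-∀
    size : ∀ c T → F c T ≤ G c T → a ≤ 2 ^ (2 + t) * commonNbrs A c T
    size c T F≤G = *-cancelʳ-≤ _ _ Q (begin
      a * Q                                ≤⟨ m≤m+n _ _ ⟩
      F c T                                ≤⟨ F≤G ⟩
      2 ^ (2 + t) * Q * commonNbrs A c T   ≡⟨ swap (2 ^ (2 + t)) Q _ ⟩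
      2 ^ (2 + t) * commonNbrs A c T * Q   ∎)
      where
      swap : ∀ p q e → p * q * e ≡ p * e * q
      swap = solve-∀
    badness : ∀ c T → F c T ≤ G c T → a ^ t * Ψ c T ≤ 2 ^ (2 + t) * Q
    badness c T F≤G = *-cancelˡ-≤ a (begin
      a * (a ^ t * Ψ c T)                  ≡⟨ *-assoc a _ _ ⟨
      a ^ suc t * Ψ c T                    ≤⟨ m≤n+m _ _ ⟩
      F c T                                ≤⟨ F≤G ⟩
      2 ^ (2 + t) * Q * commonNbrs A c T   ≤⟨ *-monoʳ-≤ (2 ^ (2 + t) * Q) (∣∣-mono {A = A ∩ nbhd c T} {A} λ w → proj₁ ∘ ∧-true⁻) ⟩
      2 ^ (2 + t) * Q * a                  ≡⟨ *-comm _ a ⟩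
      a * (2 ^ (2 + t) * Q)                ∎)

  -- The bound L will exceed Δ; weight counts, with multiplicity, the blocks in which a
  -- tuple is bad.
  record Blocks (q n d L : ℕ) : Set where
    field
      c            : Bool
      Z B          : Fin q → Subset N
      B⊆Z          : ∀ i j → i ≢ j → B i ⊆ Z j
      Z-large      : ∀ i → n ≤ ∣ Z i ∣
      weight       : List V → ℕ
      weight-pos   : ∀ i S → all (Z i) S ≡ true → ∣ B i ∩ nbhd c S ∣ < 2 * n → 0 < weight S
      weight-small : extSum full d weight [] * L ^ d < n ^ d

  -- The inclusions have different origins: the `B` of the later stage starts inside the earlier
  -- `Z`, while the earlier `B` is cut down by the later `T`. The cut uses the earlier colour, so it
  -- lands in the later `Z` only when the colours agree.
  Compatible : Stage → Stage → Set
  Compatible s e = colour s ≡ colour e → B s ⊆ Z e × B e ⊆ Z s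

  compatible-sym : ∀ {s e} → Compatible s e → Compatible e s
  compatible-sym s~e ce≡cs = let Bs⊆Ze , Be⊆Zs = s~e (sym ce≡cs) in Be⊆Zs , Bs⊆Ze

  compatible-restrict : ∀ T {s e} → Compatible s e → Compatible (restrict T s) (restrict T e)
  compatible-restrict T s~e cs≡ce =
    let Bs⊆Ze , Be⊆Zs = s~e cs≡ce in
    (λ w → Bs⊆Ze w ∘ proj₁ ∘ ∧-true⁻) , (λ w → Be⊆Zs w ∘ proj₁ ∘ ∧-true⁻)

  -- Running the choice `K` times.

  module Iteration (t x m K : ℕ) (0<m : 0 < m) (m*2^x≡N : m * 2 ^ x ≡ N) where

    -- Logarithmic losses per step: `A` shrinks by at most `2 ^ u`, and the bound on the density of
    -- bad tuples grows by `2 ^ G`.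
    u G : ℕ
    u = 2 + t
    G = u * K * t + suc u

    0<N : 0 < N
    0<N = subst (0 <_) m*2^x≡N (*-mono-≤ 0<m (m^n>0 2 x))

    instance
      N≢0 : NonZero N
      N≢0 = >-nonZero 0<N

    -- After `j` steps the tuples under control have length `D`; each step uses up `t` of it.
    -- `bad-small` bounds the density of bad tuples by `2 ^ (j * G)` over `2 ^ (x * t)`.
    record State (D j : ℕ) : Set where
      field
        A          : Subset N
        stages     : List Stage
        count      : length stages ≡ j
        A⊆Z        : All (λ st → A ⊆ Z st) stages
        compatible : AllPairs Compatible stages
        A-large    : N ≤ 2 ^ (u * j) * ∣ A ∣
        bad-small  : extSum full D (badTotal m stages) [] * 2 ^ (x * t) ≤ N ^ D * 2 ^ (j * G)

    start : ∀ D → State D 0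
    start D = record
      { A = full ; stages = [] ; count = refl ; A⊆Z = [] ; compatible = []
      ; A-large = ≤-reflexive (sym (trans (cong (λ e → 2 ^ e * ∣ full {N} ∣) (*-zeroʳ u))
                                          (trans (+-identityʳ _) (∣full∣ N))))
      ; bad-small = subst (λ e → e * 2 ^ (x * t) ≤ N ^ D * 1)
                      (sym (trans (extSum-const full 0 D []) (*-zeroʳ (∣ full {N} ∣ ^ D)))) z≤n }

    -- `T` is drawn from `A`, but densities are relative to all vertices: replacing `a ^ t` by
    -- `N ^ t` costs `2 ^ (u * j * t)`. The new bad tuples have density at most `(m / N) ^ t`, which
    -- is `1 / 2 ^ (x * t)`, and are absorbed by doubling the old bound.
    bad-step : ∀ {D j} (a P Ψ : ℕ) → j ≤ K → N ≤ 2 ^ (u * j) * a →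
               P * 2 ^ (x * t) ≤ N ^ (t + D) * 2 ^ (j * G) →
               a ^ t * Ψ ≤ 2 ^ u * (P + N ^ D * m ^ t) →
               Ψ * 2 ^ (x * t) ≤ N ^ D * 2 ^ (suc j * G)
    bad-step {D} {j} a P Ψ j≤K N≤a P-small Ψ-small = *-cancelˡ-≤ (N ^ t) (begin
      N ^ t * (Ψ * X)
        ≤⟨ *-monoˡ-≤ (Ψ * X) (^-monoˡ-≤ t N≤a) ⟩
      (2 ^ (u * j) * a) ^ t * (Ψ * X)
        ≡⟨ cong (_* (Ψ * X)) (trans (^-distribʳ-* t _ a) (cong (_* a ^ t) (^-*-assoc 2 (u * j) t))) ⟩
      2 ^ (u * j * t) * a ^ t * (Ψ * X)
        ≡⟨ regroup₁ (2 ^ (u * j * t)) (a ^ t) Ψ X ⟩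
      2 ^ (u * j * t) * (a ^ t * Ψ) * X
        ≤⟨ *-monoˡ-≤ X (*-monoʳ-≤ (2 ^ (u * j * t)) Ψ-small) ⟩
      2 ^ (u * j * t) * (2 ^ u * (P + N ^ D * m ^ t)) * X
        ≡⟨ regroup₂ (2 ^ (u * j * t)) (2 ^ u) P (N ^ D) (m ^ t) X ⟩
      2 ^ (u * j * t) * 2 ^ u * (P * X + N ^ D * (m ^ t * X))
        ≤⟨ *-monoʳ-≤ (2 ^ (u * j * t) * 2 ^ u) (+-mono-≤ P-small (≤-reflexive new)) ⟩
      2 ^ (u * j * t) * 2 ^ u * (N ^ (t + D) * 2 ^ (j * G) + N ^ (t + D))
        ≤⟨ *-monoʳ-≤ (2 ^ (u * j * t) * 2 ^ u) (+-monoʳ-≤ _ (m≤m*n (N ^ (t + D)) (2 ^ (j * G)) {{m^n≢0 2 (j * G)}})) ⟩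
      2 ^ (u * j * t) * 2 ^ u * (N ^ (t + D) * 2 ^ (j * G) + N ^ (t + D) * 2 ^ (j * G))
        ≡⟨ regroup₃ (2 ^ (u * j * t)) (2 ^ u) (N ^ (t + D)) (2 ^ (j * G)) ⟩
      N ^ (t + D) * (2 ^ (u * j * t) * 2 ^ suc u * 2 ^ (j * G))
        ≡⟨ cong (N ^ (t + D) *_) (trans (cong (_* 2 ^ (j * G)) (sym (^-distribˡ-+-* 2 (u * j * t) (suc u))))
                                        (sym (^-distribˡ-+-* 2 (u * j * t + suc u) (j * G)))) ⟩
      N ^ (t + D) * 2 ^ (u * j * t + suc u + j * G)
        ≤⟨ *-monoʳ-≤ (N ^ (t + D)) (^-monoʳ-≤ 2 (+-monoˡ-≤ (j * G) (+-monoˡ-≤ (suc u) (*-monoˡ-≤ t (*-monoʳ-≤ u j≤K))))) ⟩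
      N ^ (t + D) * 2 ^ (suc j * G)
        ≡⟨ trans (cong (_* 2 ^ (suc j * G)) (^-distribˡ-+-* N t D)) (*-assoc (N ^ t) (N ^ D) _) ⟩
      N ^ t * (N ^ D * 2 ^ (suc j * G)) ∎)
      where
      open ≤-Reasoning
      X = 2 ^ (x * t)
      instance
        N^t≢0 : NonZero (N ^ t)
        N^t≢0 = m^n≢0 N t
      regroup₁ : ∀ p a y x → p * a * (y * x) ≡ p * (a * y) * x
      regroup₁ = solve-∀
      regroup₂ : ∀ p w b n k x → p * (w * (b + n * k)) * x ≡ p * w * (b * x + n * (k * x))
      regroup₂ = solve-∀
      regroup₃ : ∀ p w n g → p * w * (n * g + n * g) ≡ n * (p * (2 * w) * g)
      regroup₃ = solve-∀
      new : N ^ D * (m ^ t * X) ≡ N ^ (t + D)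
      new = begin-equality
        N ^ D * (m ^ t * X)           ≡⟨ cong (λ y → N ^ D * (m ^ t * y)) (^-*-assoc 2 x t) ⟨
        N ^ D * (m ^ t * (2 ^ x) ^ t) ≡⟨ cong (N ^ D *_) (^-distribʳ-* t m (2 ^ x)) ⟨
        N ^ D * (m * 2 ^ x) ^ t       ≡⟨ cong (λ y → N ^ D * y ^ t) m*2^x≡N ⟩
        N ^ D * N ^ t                 ≡⟨ *-comm (N ^ D) (N ^ t) ⟩
        N ^ t * N ^ D                 ≡⟨ ^-distribˡ-+-* N t D ⟨
        N ^ (t + D)                   ∎

    step : ∀ {D j} → j ≤ K → State (t + D) j → State D (suc j)
    step {D} {j} j≤K s = record
      { A          = A ∩ nbhd c T
      ; stages     = newStages A c T stages
      ; count      = cong suc (trans (length-map (restrict T) stages) count)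
      ; A⊆Z        = (λ w → proj₂ ∘ ∧-true⁻)
                     ∷ AllP.map⁺ (All.map (λ A⊆Z w → A⊆Z w ∘ proj₁ ∘ ∧-true⁻) A⊆Z)
      ; compatible = AllP.map⁺ (All.map (λ A⊆Z → λ { refl → A⊆Z , λ w → proj₂ ∘ ∧-true⁻ }) A⊆Z)
                     ∷ AllPairsP.map⁺ (AllPairs.map (λ {s} {e} → compatible-restrict T {s} {e}) compatible)
      ; A-large    = begin
          N                                         ≤⟨ A-large ⟩
          2 ^ (u * j) * ∣ A ∣                       ≤⟨ *-monoʳ-≤ (2 ^ (u * j)) shrink ⟩
          2 ^ (u * j) * (2 ^ u * ∣ A ∩ nbhd c T ∣)  ≡⟨ regroup (2 ^ (u * j)) (2 ^ u) _ ⟩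
          2 ^ u * 2 ^ (u * j) * ∣ A ∩ nbhd c T ∣    ≡⟨ cong (_* ∣ A ∩ nbhd c T ∣) 2^[u*[1+j]] ⟨
          2 ^ (u * suc j) * ∣ A ∩ nbhd c T ∣        ∎
      ; bad-small  = bad-step ∣ A ∣ _ _ j≤K A-large bad-small badness
      }
      where
      open State s
      open ≤-Reasoning
      regroup : ∀ p q a → p * (q * a) ≡ q * p * a
      regroup = solve-∀
      2^[u*[1+j]] : 2 ^ (u * suc j) ≡ 2 ^ u * 2 ^ (u * j)
      2^[u*[1+j]] = trans (cong (2 ^_) (*-suc u j)) (^-distribˡ-+-* 2 u (u * j))
      0<∣A∣ : 0 < ∣ A ∣
      0<∣A∣ = n≢0⇒n>0 λ ∣A∣≡0 → contradiction
        (≤-trans 0<N (≤-trans A-large (≤-reflexive (trans (cong (2 ^ (u * j) *_) ∣A∣≡0) (*-zeroʳ (2 ^ (u * j))))))) λ ()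
      choice = dependent-random-choice A t D m stages 0<∣A∣ 0<N 0<m A⊆Z
      c = proj₁ choice
      T = proj₁ (proj₂ choice)
      shrink : ∣ A ∣ ≤ 2 ^ u * ∣ A ∩ nbhd c T ∣
      shrink = proj₁ (proj₂ (proj₂ (proj₂ choice)))
      badness : ∣ A ∣ ^ t * extSum full D (badTotal m (newStages A c T stages)) []
              ≤ 2 ^ u * (extSum full (t + D) (badTotal m stages) [] + N ^ D * m ^ t)
      badness = proj₂ (proj₂ (proj₂ (proj₂ choice)))

    -- This is `d + r * t`, in the recursive form matching the index `t + D` consumed by `step`;
    -- after `K` steps exactly `d`-tuples remain under control.
    budget : ℕ → ℕ → ℕ
    budget d zero    = d
    budget d (suc r) = t + budget d r

    run : ∀ d r j → j + r ≤ K → State (budget d r) j → State d (j + r)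
    run d zero    j _     s = subst (State d) (sym (+-identityʳ j)) s
    run d (suc r) j j+r≤K s = subst (State d) (sym (+-suc j r))
      (run d r (suc j) (≤-trans (≤-reflexive (sym (+-suc j r))) j+r≤K) (step (m+n≤o⇒m≤o j j+r≤K) s))

    chain : ∀ d → State d K
    chain d = run d K 0 ≤-refl (start (budget d K))

  -- Selecting `q` stages of one colour.

  ofColour : Bool → List Stage → List Stage
  ofColour c = filter (λ st → colour st ≟ c)

  length-ofColour : ∀ sts → length (ofColour true sts) + length (ofColour false sts) ≡ length sts
  length-ofColour []                     = refl
  length-ofColour (stage true  _ _ ∷ sts) = cong suc (length-ofColour sts)
  length-ofColour (stage false _ _ ∷ sts) = trans (+-suc _ _) (cong suc (length-ofColour sts))

  frequent-colour : ∀ q sts → length sts ≡ q + q → ∃ λ c → q ≤ length (ofColour c sts)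
  frequent-colour q sts len with q ≤? length (ofColour true sts) | q ≤? length (ofColour false sts)
  ... | yes q≤ | _      = true  , q≤
  ... | no  _  | yes q≤ = false , q≤
  ... | no  q≰ | no  q≰′ = contradiction (trans (length-ofColour sts) len)
                             (<⇒≢ (+-mono-< (≰⇒> q≰) (≰⇒> q≰′)))

  badTotal-ofColour : ∀ m c sts S → badTotal m (ofColour c sts) S ≤ badTotal m sts S
  badTotal-ofColour m c []        S = z≤n
  badTotal-ofColour m c (st ∷ sts) S with does (colour st ≟ c)
  ... | true  = +-monoʳ-≤ (bad m st S) (badTotal-ofColour m c sts S)
  ... | false = ≤-trans (badTotal-ofColour m c sts S) (m≤n+m _ (bad m st S))

  bad≤badTotal : ∀ m sts S i → bad m (lookup sts i) S ≤ badTotal m sts S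
  bad≤badTotal m (st ∷ sts) S zero    = m≤m+n _ _
  bad≤badTotal m (st ∷ sts) S (suc i) = ≤-trans (bad≤badTotal m sts S i) (m≤n+m _ (bad m st S))

  -- The final `A` lies in every `Z` and keeps at least `n` vertices, as the total shrinking is at
  -- most `2 ^ x`. The threshold `2 * n` leaves room for `n` occupied and fewer than `n` blocked
  -- vertices in the embedding.
  blocks : ∀ q n d t x L → 0 < n → 2 * n * 2 ^ x ≡ N → (2 + t) * (q + q) ≤ x →
           N ^ d * 2 ^ ((q + q) * ((2 + t) * (q + q) * t + suc (2 + t))) * L ^ d < n ^ d * 2 ^ (x * t) →
           Blocks q n d L
  blocks q n d t x L 0<n N≡ uK≤x small = record
    { c            = c
    ; Z            = Z ∘ st
    ; B            = B ∘ st
    ; B⊆Z          = λ i j i≢j → proj₁ (lookup-AllPairs compatible-sym (AllPairsP.filter⁺ (λ st → colour st ≟ c) compatible)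
                       (ix i) (ix j) (i≢j ∘ Fin.inject≤-injective q≤ q≤ i j) (trans (colour≡c i) (sym (colour≡c j))))
    ; Z-large      = λ i → ≤-trans n≤∣A∣ (∣∣-mono {A = A}
                       (All.lookup (AllP.filter⁺ (λ st → colour st ≟ c) A⊆Z) (∈-lookup (ix i))))
    ; weight       = weight
    ; weight-pos   = λ i S Z∋S few → ≤-trans (is-bad i S Z∋S few) (bad≤badTotal (2 * n) (ofColour c stages) S (ix i))
    ; weight-small = *-cancelʳ-< X (extSum full d weight [] * L ^ d) (n ^ d) (begin-strict
        extSum full d weight [] * L ^ d * X
          ≤⟨ *-monoˡ-≤ X (*-monoˡ-≤ (L ^ d)
               (extSum-mono {A = full} (λ S _ → badTotal-ofColour (2 * n) c stages S) d [] refl)) ⟩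
        extSum full d (badTotal (2 * n) stages) [] * L ^ d * X
          ≡⟨ swap (extSum full d (badTotal (2 * n) stages) []) (L ^ d) X ⟩
        extSum full d (badTotal (2 * n) stages) [] * X * L ^ d
          ≤⟨ *-monoˡ-≤ (L ^ d) bad-small ⟩
        N ^ d * 2 ^ ((q + q) * G) * L ^ d
          <⟨ small ⟩
        n ^ d * X ∎)
    }
    where
    open ≤-Reasoning
    open Iteration t x (2 * n) (q + q) (≤-trans 0<n (m≤m+n n _)) N≡
    open State (chain d)
    X = 2 ^ (x * t)
    swap : ∀ a b c → a * b * c ≡ a * c * b
    swap = solve-∀
    c = proj₁ (frequent-colour q stages count)
    q≤ = proj₂ (frequent-colour q stages count)
    weight : List V → ℕ
    weight = badTotal (2 * n) (ofColour c stages)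
    ix : Fin q → Fin (length (ofColour c stages))
    ix i = inject≤ i q≤
    st : Fin q → Stage
    st i = lookup (ofColour c stages) (ix i)
    colour≡c : ∀ i → colour (st i) ≡ c
    colour≡c i = All.lookup (AllP.all-filter (λ st → colour st ≟ c) stages) (∈-lookup (ix i))
    n≤∣A∣ : n ≤ ∣ A ∣
    n≤∣A∣ = *-cancelʳ-≤ n ∣ A ∣ (2 ^ x) {{m^n≢0 2 x}} (begin
      n * 2 ^ x                       ≤⟨ *-monoˡ-≤ (2 ^ x) (m≤m+n n _) ⟩
      2 * n * 2 ^ x                   ≡⟨ N≡ ⟩
      N                               ≤⟨ A-large ⟩
      2 ^ ((2 + t) * (q + q)) * ∣ A ∣ ≤⟨ *-monoˡ-≤ ∣ A ∣ (^-monoʳ-≤ 2 uK≤x) ⟩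
      2 ^ x * ∣ A ∣                   ≡⟨ *-comm (2 ^ x) ∣ A ∣ ⟩
      ∣ A ∣ * 2 ^ x                   ∎)
    is-bad : ∀ i S → all (Z (st i)) S ≡ true → ∣ B (st i) ∩ nbhd c S ∣ < 2 * n → 0 < bad (2 * n) (st i) S
    is-bad i S Z∋S few = ≤-reflexive (sym (cong 𝟙 (∧-true⁺ Z∋S (Equivalence.to T-≡ (<⇒<ᵇ
      (subst (λ c → ∣ B (st i) ∩ nbhd c S ∣ < 2 * n) (sym (colour≡c i)) few))))))

-- Greedy embedding

module Embedding {n N q d Δ L : ℕ} (H : Graph n) (χ : Colouring N) (π : Permutation′ n)
  (degenerate : ∀ i → backDegree H π i ≤ d × numTraces H π i ≤ Δ)
  (κ : Fin n → Fin q) (proper : ∀ i j → Adj H i j ≡ true → κ i ≢ κ j)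
  (0<n : 0 < n) (0<N : 0 < N) (Δ<L : Δ < L) (bl : Monochromatic.Blocks χ q n d L) where

  open Monochromatic χ
  open Blocks bl

  private
    V = Fin N
    instance
      n≢0 : NonZero n
      n≢0 = >-nonZero 0<n
      L≢0 : NonZero L
      L≢0 = >-nonZero (≤-<-trans z≤n Δ<L)

  -- The extensions of `S` to `d`-tuples carry weight below `(n / L) ^ k`. For a `d`-tuple this
  -- means weight zero; for the empty tuple it is `weight-small`.
  Good : List V → Set
  Good S = extSum full k weight S * L ^ k < n ^ k
    where k = d ∸ length S

  good? : ∀ S → Dec (Good S)
  good? S = _ <? _

  isBad : List V → ℕ
  isBad S = 𝟙 (does (¬? (good? S)))

  isBad≡0⇒good : ∀ S → isBad S ≡ 0 → Good S
  isBad≡0⇒good S = decided (good? S)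
    where
    decided : ∀ {P : Set} (P? : Dec P) → 𝟙 (does (¬? P?)) ≡ 0 → P
    decided (yes p) _ = p

  -- Each bad extension by one vertex carries weight at least `(n / L) ^ k`, so more than `n / L` of
  -- them would make `S` itself bad.
  few-bad-extensions : ∀ S → length S < d → Good S → ∑[ w < N ] isBad (w ∷ S) * L ≤ n
  few-bad-extensions S S<d good = <⇒≤ (*-cancelʳ-< (n ^ k) (bads * L) n (begin-strict
    bads * L * n ^ k
      ≡⟨ swap bads L (n ^ k) ⟩
    L * (n ^ k * bads)
      ≡⟨ cong (L *_) (*-distribˡ-sum (n ^ k) (λ w → isBad (w ∷ S))) ⟩
    L * ∑[ w < N ] (n ^ k * isBad (w ∷ S))
      ≤⟨ *-monoʳ-≤ L (sum-mono-≤ λ w → pointwise w) ⟩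
    L * ∑[ w < N ] (L ^ k * (1 * extSum full k weight (w ∷ S)))
      ≡⟨ cong (L *_) (*-distribˡ-sum (L ^ k) (λ w → 1 * extSum full k weight (w ∷ S))) ⟨
    L * (L ^ k * extSum full (suc k) weight S)
      ≡⟨ regroup L (L ^ k) _ ⟩
    extSum full (suc k) weight S * L ^ suc k
      <⟨ subst (λ k → extSum full k weight S * L ^ k < n ^ k) (sym k+1) good ⟩
    n * n ^ k ∎))
    where
    open ≤-Reasoning
    k bads : ℕ
    k = d ∸ suc (length S)
    bads = ∑[ w < N ] isBad (w ∷ S)
    k+1 : suc k ≡ d ∸ length S
    k+1 = sym (+-∸-assoc 1 S<d)
    swap : ∀ b l m → b * l * m ≡ l * (m * b)
    swap = solve-∀
    regroup : ∀ l m e → l * (m * e) ≡ e * (l * m)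
    regroup = solve-∀
    pointwise : ∀ w → n ^ k * isBad (w ∷ S) ≤ L ^ k * (1 * extSum full k weight (w ∷ S))
    pointwise w = ≤-trans (decided (good? (w ∷ S))) (≤-reflexive (reorder (extSum full k weight (w ∷ S)) (L ^ k)))
      where
      decided : ∀ {a b} (a<b? : Dec (a < b)) → b * 𝟙 (does (¬? a<b?)) ≤ a
      decided {_} {b} (yes _)  = ≤-trans (≤-reflexive (*-zeroʳ b)) z≤n
      decided {_} {b} (no a≮b) = ≤-trans (≤-reflexive (*-identityʳ b)) (≮⇒≥ a≮b)
      reorder : ∀ e l → e * l ≡ l * (1 * e)
      reorder = solve-∀

  -- If S is bad, so is each of its extensions inside Z i, and |Z i| ≥ n.
  few-persists : ∀ i k S → all (Z i) S ≡ true → ∣ B i ∩ nbhd c S ∣ < 2 * n → n ^ k ≤ extSum full k weight S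
  few-persists i zero    S Z∋S few = weight-pos i S Z∋S few
  few-persists i (suc k) S Z∋S few = begin
    n * n ^ k                                             ≤⟨ *-monoˡ-≤ (n ^ k) (Z-large i) ⟩
    ∣ Z i ∣ * n ^ k                                       ≡⟨ sum-𝟙-* (Z i) (n ^ k) ⟨
    ∑[ w < N ] (𝟙 (Z i w) * n ^ k)                        ≤⟨ sum-mono-≤ (λ w → step w (Z i w) refl) ⟩
    ∑[ w < N ] (1 * extSum full k weight (w ∷ S))         ∎
    where
    open ≤-Reasoning
    step : ∀ w b → Z i w ≡ b → 𝟙 b * n ^ k ≤ 1 * extSum full k weight (w ∷ S)
    step w false _   = z≤n
    step w true  Z∋w = +-monoˡ-≤ 0 (few-persists i k (w ∷ S) (∧-true⁺ Z∋w Z∋S)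
      (≤-<-trans (∣∣-mono {A = B i ∩ nbhd c (w ∷ S)} {B i ∩ nbhd c S} λ z z∈ →
        let z∈B , z∈nbhd = ∧-true⁻ {B i z} z∈ in ∧-true⁺ z∈B (proj₂ (∧-true⁻ {hit c z w} z∈nbhd))) few))

  -- Otherwise the extensions of `S` carry weight at least `n ^ k`, which goodness forbids because
  -- `L ^ k` is positive.
  good⇒many-common-nbrs : ∀ i S → all (Z i) S ≡ true → Good S → 2 * n ≤ ∣ B i ∩ nbhd c S ∣
  good⇒many-common-nbrs i S Z∋S good = ≮⇒≥ λ few → <⇒≱ good
    (≤-trans (few-persists i k S Z∋S few) (m≤m*n _ (L ^ k) {{m^n≢0 L k}}))
    where k = d ∸ length S

  vertex : Fin n → Fin n
  vertex a = π ⟨$⟩ʳ a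

  nbr : Fin n → Fin n → Bool
  nbr j a = Adj H (vertex j) (vertex a)

  below : ℕ → Fin n → Fin n → Bool
  below k j a = (toℕ a <ᵇ k) ∧ nbr j a

  nbrImgs : ℕ → Fin n → (Fin n → V) → List V
  nbrImgs k j g = imgs (tabulate (below k j)) g

  below⁻ : ∀ {k j a} → below k j a ≡ true → toℕ a < k × nbr j a ≡ true
  below⁻ {k} {j} {a} eq = let a<k , adj = ∧-true⁻ eq in <ᵇ⇒< (toℕ a) k (Equivalence.from T-≡ a<k) , adj

  below⁺ : ∀ {k j a} → toℕ a < k → nbr j a ≡ true → below k j a ≡ true
  below⁺ a<k adj = ∧-true⁺ (Equivalence.to T-≡ (<⇒<ᵇ a<k)) adj

  trace-below : ∀ i j → trace H π i j ≡ tabulate (below (suc (toℕ i)) j)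
  trace-below i j = tabulate-cong λ a → cong (_∧ nbr j a) (≤ᵇ-<ᵇ (toℕ a) (toℕ i))
    where
    ≤ᵇ-<ᵇ : ∀ a i → (a Nat.≤ᵇ i) ≡ (a <ᵇ suc i)
    ≤ᵇ-<ᵇ zero    i = refl
    ≤ᵇ-<ᵇ (suc a) i = refl

  -- `g` is total, with junk from position `k` on. `good` includes position `k` itself, which
  -- supplies the candidates for the next vertex.
  record Partial (k : ℕ) : Set where
    field
      g    : Fin n → V
      inj  : ∀ a b → toℕ a < toℕ b → toℕ b < k → g a ≢ g b
      g∈B  : ∀ a → toℕ a < k → B (κ (vertex a)) (g a) ≡ true
      mono : ∀ a b → toℕ a < toℕ b → toℕ b < k → nbr b a ≡ true → hit c (g b) (g a) ≡ true
      good : ∀ j → k ≤ toℕ j → Good (nbrImgs k j g)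

  start : Partial 0
  start = record
    { g = λ _ → fromℕ< 0<N ; inj = λ _ _ _ () ; g∈B = λ _ () ; mono = λ _ _ _ ()
    ; good = λ j _ → subst Good (sym (imgs-none {n = n} (λ _ → fromℕ< 0<N))) weight-small }

  extend : ∀ i → Partial (toℕ i) → Partial (suc (toℕ i))
  extend i part = record
    { g    = g′
    ; inj  = λ a b a<b b≤i → case splitℕ b≤i of λ
        { (inj₁ b<i) → subst₂ _≢_ (sym (old a (<-trans a<b b<i))) (sym (old b b<i)) (inj a b a<b b<i)
        ; (inj₂ refl) → subst₂ _≢_ (sym (old a a<b)) (sym new) (unused a) }
    ; g∈B  = λ a a≤i → case splitℕ a≤i of λ
        { (inj₁ a<i) → trans (cong (B (κ (vertex a))) (old a a<i)) (g∈B a a<i)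
        ; (inj₂ refl) → trans (cong (B (κ (vertex a))) new) (proj₁ (∧-true⁻ w∈C)) }
    ; mono = λ a b a<b b≤i adj → case splitℕ b≤i of λ
        { (inj₁ b<i) → trans (cong₂ (hit c) (old b b<i) (old a (<-trans a<b b<i))) (mono a b a<b b<i adj)
        ; (inj₂ refl) → trans (cong₂ (hit c) new (old a a<b))
            (all-imgs⁻ (hit c w) (below (toℕ i) i) g (proj₂ (∧-true⁻ {B (κ (vertex i)) w} w∈C)) a (below⁺ a<b adj)) }
    ; good = good′
    }
    where
    open ≤-Reasoning
    open Partial part
    S = nbrImgs (toℕ i) i g
    C : Subset N
    C = B (κ (vertex i)) ∩ nbhd c S

    laterNbr : Fin n → Bool
    laterNbr j = (toℕ i <ᵇ toℕ j) ∧ nbr i j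

    -- Later neighbours with the same trace have the same list of images, so the union bound runs
    -- over at most `Δ` traces instead of all later neighbours.
    traces : List (Vec Bool n)
    traces = deduplicate (≡-dec _≟_) (map (trace H π i) (filterᵇ laterNbr (allFin n)))

    -- used also counts the junk values of g at vertices not yet placed: this costs
    -- nothing, as at most n candidates are excluded in any case.
    used blocked : V → ℕ
    used w = ∑[ a < n ] 𝟙 (does (g a Fin.≟ w))
    blocked w = sumᴸ (map (λ τ → isBad (imgs τ (updateAt g i (const w)))) traces)

    imgs-trace : ∀ {j} → nbr j i ≡ true → ∀ w → imgs (trace H π i j) (updateAt g i (const w)) ≡ w ∷ nbrImgs (toℕ i) j g
    imgs-trace {j} adj w = trans (cong (λ τ → imgs τ (updateAt g i (const w))) (trace-below i j))
      (trans (imgs-updateAt (nbr j) i w g) (cong (λ b → (if b then w ∷_ else id) (nbrImgs (toℕ i) j g)) adj))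

    -- Position `i` is one more earlier neighbour of `j`, hence strictness. `g i` serves as a dummy
    -- image, since only lengths matter.
    nbrImgs-short : ∀ {j} → toℕ i < toℕ j → nbr j i ≡ true → length (nbrImgs (toℕ i) j g) < d
    nbrImgs-short {j} i<j adj = begin-strict
      length (nbrImgs (toℕ i) j g)
        <⟨ n<1+n _ ⟩
      length (g i ∷ nbrImgs (toℕ i) j g)
        ≡⟨ cong length (trans (sym (imgs-trace adj (g i))) (cong (λ τ → imgs τ _) (trace-below i j))) ⟩
      length (nbrImgs (suc (toℕ i)) j (updateAt g i (const (g i))))
        ≤⟨ length-imgs (below (suc (toℕ i)) j) (below (toℕ j) j) id _
             (λ a eq → let a≤i , adj = below⁻ eq in below⁺ (≤-trans a≤i i<j) adj) ⟩
      backDegree H π j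
        ≤⟨ proj₁ (degenerate j) ⟩
      d ∎

    traces-few-bad : All (λ τ → ∑[ w < N ] isBad (imgs τ (updateAt g i (const w))) * L ≤ n) traces
    traces-few-bad = All.tabulate λ τ∈ → case ∈-map⁻ (trace H π i) (∈-deduplicate⁻ (≡-dec _≟_) _ τ∈) of λ
      { (j , j∈ , refl) →
          let i<ᵇj , adj = ∧-true⁻ (Equivalence.to T-≡ (proj₂ (∈-filter⁻ (T? ∘ laterNbr) {xs = allFin n} j∈)))
              i<j = <ᵇ⇒< (toℕ i) (toℕ j) (Equivalence.from T-≡ i<ᵇj)
              adj′ = trans (Graph.sym H (vertex j) (vertex i)) adj
          in ≤-trans (≤-reflexive (cong (_* L) (sum-cong-≗ λ w → cong isBad (imgs-trace adj′ w))))
                     (few-bad-extensions (nbrImgs (toℕ i) j g) (nbrImgs-short i<j adj′) (good j (<⇒≤ i<j))) }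

    few-blocked : sum blocked < n
    few-blocked = *-cancelʳ-< L (sum blocked) n (begin-strict
      sum blocked * L      ≡⟨ cong (_* L) (∑-sumᴸ (λ τ w → isBad (imgs τ (updateAt g i (const w)))) traces) ⟩
      sumᴸ (map (λ τ → ∑[ w < N ] isBad (imgs τ (updateAt g i (const w)))) traces) * L
                           ≤⟨ sumᴸ-*-≤ (λ τ → ∑[ w < N ] isBad (imgs τ (updateAt g i (const w)))) L n traces-few-bad ⟩
      length traces * n    ≤⟨ *-monoˡ-≤ n (proj₂ (degenerate i)) ⟩
      Δ * n                <⟨ *-monoˡ-< n Δ<L ⟩
      L * n                ≡⟨ *-comm L n ⟩
      n * L                ∎)

    few-used : sum used ≡ n
    few-used = trans (∑-comm (λ w a → 𝟙 (does (g a Fin.≟ w))))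
                     (trans (sum-cong-≗ (λ a → ∑-𝟙-≟ (g a))) (∣full∣ n))

    -- Adjacent vertices have different colours under `κ`, so these images lie in blocks other than
    -- that of `i`.
    Z∋S : all (Z (κ (vertex i))) S ≡ true
    Z∋S = all-imgs⁺ (Z (κ (vertex i))) (below (toℕ i) i) g λ a eq →
      let a<i , adj = below⁻ eq in B⊆Z _ _ (≢-sym (proper (vertex i) (vertex a) adj)) (g a) (g∈B a a<i)

    choice : ∃ λ w → used w + blocked w < 𝟙 (C w)
    -- Being below an indicator packs three facts: `w` is a candidate, is not in use, and makes no
    -- trace bad.
    choice = sum<sum⇒∃< (λ w → used w + blocked w) (𝟙 ∘ C) (begin-strict
      ∑[ w < N ] (used w + blocked w) ≡⟨ ∑-distrib-+ used blocked ⟩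
      sum used + sum blocked          <⟨ +-mono-≤-< (≤-reflexive few-used) few-blocked ⟩
      n + n                           ≡⟨ cong (n +_) (+-identityʳ n) ⟨
      2 * n                           ≤⟨ good⇒many-common-nbrs (κ (vertex i)) S Z∋S (good i ≤-refl) ⟩
      ∣ C ∣                           ∎)

    w : V
    w = proj₁ choice

    below-𝟙 : ∀ {m b} → m < 𝟙 b → b ≡ true × m ≡ 0
    below-𝟙 {zero} {true} _         = refl , refl
    below-𝟙 {suc m} {true} (s≤s ())

    w∈C : C w ≡ true
    w∈C = proj₁ (below-𝟙 (proj₂ choice))

    w-free : used w + blocked w ≡ 0
    w-free = proj₂ (below-𝟙 {b = C w} (proj₂ choice))

    unused : ∀ a → g a ≢ w
    unused a ga≡w = contradiction
      (≤-trans (term≤sum (λ a → 𝟙 (does (g a Fin.≟ w))) a) (≤-reflexive (m+n≡0⇒m≡0 (used w) w-free)))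
      (<⇒≱ (≤-reflexive (sym (cong 𝟙 (dec-true (g a Fin.≟ w) ga≡w)))))

    g′ : Fin n → V
    g′ = updateAt g i (const w)

    new : g′ i ≡ w
    new = updateAt-updates i g

    old : ∀ a → toℕ a < toℕ i → g′ a ≡ g a
    old a a<i = updateAt-minimal a i g λ { refl → <-irrefl refl a<i }

    splitℕ : ∀ {a} → toℕ a < suc (toℕ i) → toℕ a < toℕ i ⊎ a ≡ i
    splitℕ a≤i with m≤n⇒m<n∨m≡n (m<1+n⇒m≤n a≤i)
    ... | inj₁ a<i = inj₁ a<i
    ... | inj₂ a≡i = inj₂ (Fin.toℕ-injective a≡i)

    -- If `j` is not adjacent to `i`, its list of images is unchanged; otherwise its trace is listed
    -- in `traces`, and `w` was chosen unblocked.
    good′ : ∀ j → suc (toℕ i) ≤ toℕ j → Good (nbrImgs (suc (toℕ i)) j g′)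
    good′ j i<j with nbr j i in adj
    ... | false = subst Good (sym (trans (imgs-updateAt (nbr j) i w g)
                    (cong (λ b → (if b then w ∷_ else id) (nbrImgs (toℕ i) j g)) adj))) (good j (<⇒≤ i<j))
    ... | true  = subst (λ τ → Good (imgs τ g′)) (trace-below i j) (isBad≡0⇒good (imgs (trace H π i j) g′) (n≤0⇒n≡0
                    (≤-trans (term≤sumᴸ (λ τ → isBad (imgs τ g′)) trace∈)
                             (≤-reflexive (m+n≡0⇒n≡0 (used w) w-free)))))
      where
      trace∈ : trace H π i j ∈ traces
      trace∈ = ∈-deduplicate⁺ (≡-dec _≟_) (∈-map⁺ (trace H π i)
        (∈-filter⁺ (T? ∘ laterNbr) (∈-allFin j)
          (Equivalence.from T-≡ (∧-true⁺ (Equivalence.to T-≡ (<⇒<ᵇ i<j))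
            (trans (Graph.sym H (vertex i) (vertex j)) adj)))))

  complete : ∀ k → k ≤ n → Partial k
  complete zero    _   = start
  complete (suc k) k<n = subst (Partial ∘ suc) (Fin.toℕ-fromℕ< k<n)
    (extend (fromℕ< k<n) (subst Partial (sym (Fin.toℕ-fromℕ< k<n)) (complete k (<⇒≤ k<n))))

  mono-copy : MonoCopy H χ
  mono-copy = g ∘ pos , (λ {x} {y} → injective x y) , c , monochromatic
    where
    open Partial (complete n ≤-refl)
    pos : Fin n → Fin n
    pos x = π ⟨$⟩ˡ x
    pos-injective : ∀ {x y} → pos x ≡ pos y → x ≡ y
    pos-injective eq = trans (sym (inverseʳ π)) (trans (cong (π ⟨$⟩ʳ_) eq) (inverseʳ π))
    injective : ∀ x y → g (pos x) ≡ g (pos y) → x ≡ y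
    injective x y eq with <-cmp (toℕ (pos x)) (toℕ (pos y))
    ... | tri< x<y _ _ = contradiction eq (inj _ _ x<y (Fin.toℕ<n (pos y)))
    ... | tri≈ _ x≡y _ = pos-injective (Fin.toℕ-injective x≡y)
    ... | tri> _ _ y<x = contradiction (sym eq) (inj _ _ y<x (Fin.toℕ<n (pos x)))
    hit⇒col : ∀ x y → hit c x y ≡ true → col χ x y ≡ c
    hit⇒col x y eq with col χ x y ≟ c
    ... | yes col≡c = col≡c
    forward : ∀ x y → toℕ (pos x) < toℕ (pos y) → Adj H y x ≡ true → col χ (g (pos y)) (g (pos x)) ≡ c
    forward x y x<y adj = hit⇒col _ _ (mono (pos x) (pos y) x<y (Fin.toℕ<n (pos y))
      (trans (cong₂ (Adj H) (inverseʳ π) (inverseʳ π)) adj))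
    monochromatic : ∀ x y → Adj H x y ≡ true → col χ (g (pos x)) (g (pos y)) ≡ c
    monochromatic x y adj with <-cmp (toℕ (pos x)) (toℕ (pos y))
    ... | tri< x<y _ _ = trans (colSym χ _ _) (forward x y x<y (trans (Graph.sym H y x) adj))
    ... | tri≈ _ x≡y _ = contradiction
            (trans (sym adj) (trans (cong (λ z → Adj H z y) (pos-injective (Fin.toℕ-injective x≡y))) (irrefl H y))) λ ()
    ... | tri> _ _ y<x = forward y x y<x adj

-- Choice of parameters

module Parameters (n d q p s ℓ : ℕ) (1≤n : 1 ≤ n) (1≤d : 1 ≤ d) (1≤q : 1 ≤ q) (1≤p : 1 ≤ p) (p≤s : p ≤ s) where

  open ≤-Reasoning

  private
    instance
      p≢0 : NonZero p
      p≢0 = >-nonZero 1≤p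
      n≢0 : NonZero n
      n≢0 = >-nonZero 1≤n
      d≢0 : NonZero d
      d≢0 = >-nonZero 1≤d
      q≢0 : NonZero q
      q≢0 = >-nonZero 1≤q

  -- υ is 1/δ = s/p rounded up and ℓ is log Δ.  A step with t-tuples controls d-tuples of
  -- final vertices once x t exceeds the total loss O(q² t²) + d (x + ℓ), whence t ~ d/δ
  -- and then x ~ q² d/δ + δ ℓ.
  υ w a t x : ℕ
  υ = suc (s / p)
  w = ℓ / υ
  a = d * υ
  t = 2 * a
  x = 64 * (q * q * a) + (4 + w)

  s≤υp : s ≤ υ * p
  s≤υp = <⇒≤ (m<[1+m/n]*n s p)

  υp≤2s : υ * p ≤ 2 * s
  υp≤2s = +-mono-≤ p≤s (≤-trans (m/n*n≤m s p) (≤-reflexive (sym (+-identityʳ s))))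

  wυ≤ℓ : w * υ ≤ ℓ
  wυ≤ℓ = m/n*n≤m ℓ υ

  private
    instance
      a≢0 : NonZero a
      a≢0 = m*n≢0 d υ

  q≤q² : q ≤ q * q
  q≤q² = m≤m*n q q

  1≤a : 1 ≤ a
  1≤a = *-mono-≤ 1≤d (s≤s (z≤n {s / p}))

  few-choices : (2 + t) * (q + q) ≤ x
  few-choices = begin
    (2 + 2 * a) * (q + q)          ≤⟨ *-monoˡ-≤ (q + q) (+-monoˡ-≤ (2 * a) (*-monoʳ-≤ 2 1≤a)) ⟩
    (2 * a + 2 * a) * (q + q)      ≡⟨ collect a q ⟩
    8 * (q * a)                    ≤⟨ *-mono-≤ (m≤m+n 8 56) (*-monoˡ-≤ a q≤q²) ⟩
    64 * (q * q * a)               ≤⟨ m≤m+n _ (4 + w) ⟩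
    x                              ∎
    where
    collect : ∀ a q → (2 * a + 2 * a) * (q + q) ≡ 8 * (q * a)
    collect = solve-∀

  loss : ℕ
  loss = (q + q) * ((2 + t) * (q + q) * t + suc (2 + t))

  -- Since `q` and `a` are positive, every term is a multiple of at most `q * q * a * a`; the total
  -- of 42 stays below the 64 built into `x`.
  loss-bound : loss ≤ 64 * (q * q * a) * a
  loss-bound = begin
    loss
      ≡⟨ expand a q ⟩
    16 * P + (16 * (q * q * a) + (4 * (q * a) + 6 * q))
      ≤⟨ +-monoʳ-≤ (16 * P) (+-mono-≤ (*-monoʳ-≤ 16 q²a≤P)
           (+-mono-≤ (*-monoʳ-≤ 4 qa≤P) (*-monoʳ-≤ 6 (≤-trans (m≤m*n q a) qa≤P)))) ⟩
    16 * P + (16 * P + (4 * P + 6 * P))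
      ≡⟨ collect P ⟩
    42 * P
      ≤⟨ *-monoˡ-≤ P (m≤m+n 42 22) ⟩
    64 * P
      ≡⟨ *-assoc 64 (q * q * a) a ⟨
    64 * (q * q * a) * a ∎
    where
    P = q * q * a * a
    q²a≤P : q * q * a ≤ P
    q²a≤P = m≤m*n (q * q * a) a
    qa≤P : q * a ≤ P
    qa≤P = ≤-trans (*-monoˡ-≤ a q≤q²) q²a≤P
    expand : ∀ a q → (q + q) * ((2 + 2 * a) * (q + q) * (2 * a) + (3 + 2 * a))
           ≡ 16 * (q * q * a * a) + (16 * (q * q * a) + (4 * (q * a) + 6 * q))
    expand = solve-∀
    collect : ∀ P → 16 * P + (16 * P + (4 * P + 6 * P)) ≡ 42 * P
    collect = solve-∀

  -- Of the two halves `x * a` of `x * t`, one pays for `x * d`. In the other, the first summand of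
  -- `x` pays for `loss`, and `(4 + w) * a` exceeds the remaining `(2 + ℓ) * d`.
  exponents : (1 + x) * d + loss + suc ℓ * d < x * t
  exponents = begin-strict
    (1 + x) * d + loss + suc ℓ * d
      ≡⟨ gather d x loss ℓ ⟩
    x * d + (loss + (2 + ℓ) * d)
      <⟨ +-monoʳ-< (x * d) (+-mono-≤-< loss-bound (*-monoˡ-< d (+-monoˡ-< ℓ {2} {4} (s≤s (s≤s (s≤s z≤n)))))) ⟩
    x * d + (64 * (q * q * a) * a + (4 + ℓ) * d)
      ≤⟨ +-mono-≤ (*-monoʳ-≤ x (m≤m*n d υ)) (+-monoʳ-≤ (64 * (q * q * a) * a)
           (≤-trans (*-monoˡ-≤ d 4+ℓ≤) (≤-reflexive (regroup (4 + w) υ d)))) ⟩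
    x * a + (64 * (q * q * a) * a + (4 + w) * a)
      ≡⟨ cong (x * a +_) (*-distribʳ-+ a (64 * (q * q * a)) (4 + w)) ⟨
    x * a + x * a
      ≡⟨ double x a ⟩
    x * t ∎
    where
    gather : ∀ d x k ℓ → (1 + x) * d + k + (1 + ℓ) * d ≡ x * d + (k + (2 + ℓ) * d)
    gather = solve-∀
    regroup : ∀ w υ d → w * υ * d ≡ w * (d * υ)
    regroup = solve-∀
    double : ∀ x a → x * a + x * a ≡ x * (2 * a)
    double = solve-∀
    4+ℓ≤ : 4 + ℓ ≤ (4 + w) * υ
    4+ℓ≤ = begin
      4 + ℓ                   ≡⟨⟩
      3 + suc ℓ               ≤⟨ +-mono-≤ (m≤m*n 3 υ) (m<[1+m/n]*n ℓ υ) ⟩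
      3 * υ + suc w * υ       ≡⟨ *-distribʳ-+ υ 3 (suc w) ⟨
      (4 + w) * υ             ∎

  N : ℕ
  N = 2 * n * 2 ^ x

  N^ : ∀ k → N ^ k ≡ n ^ k * 2 ^ ((1 + x) * k)
  N^ k = begin-equality
    N ^ k                          ≡⟨ cong (_^ k) (regroup n (2 ^ x)) ⟩
    (n * 2 ^ (1 + x)) ^ k          ≡⟨ ^-distribʳ-* k n (2 ^ (1 + x)) ⟩
    n ^ k * (2 ^ (1 + x)) ^ k      ≡⟨ cong (n ^ k *_) (^-*-assoc 2 (1 + x) k) ⟩
    n ^ k * 2 ^ ((1 + x) * k)      ∎
    where
    regroup : ∀ n y → 2 * n * y ≡ n * (2 * y)
    regroup = solve-∀

  weight-budget : N ^ d * 2 ^ loss * (2 ^ suc ℓ) ^ d < n ^ d * 2 ^ (x * t)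
  weight-budget = begin-strict
    N ^ d * 2 ^ loss * (2 ^ suc ℓ) ^ d
      ≡⟨ cong₂ (λ y z → y * 2 ^ loss * z) (N^ d) (^-*-assoc 2 (suc ℓ) d) ⟩
    n ^ d * 2 ^ ((1 + x) * d) * 2 ^ loss * 2 ^ (suc ℓ * d)
      ≡⟨ regroup (n ^ d) _ (2 ^ loss) _ ⟩
    n ^ d * (2 ^ ((1 + x) * d) * 2 ^ loss * 2 ^ (suc ℓ * d))
      ≡⟨ cong (λ y → n ^ d * (y * 2 ^ (suc ℓ * d))) (^-distribˡ-+-* 2 ((1 + x) * d) loss) ⟨
    n ^ d * (2 ^ ((1 + x) * d + loss) * 2 ^ (suc ℓ * d))
      ≡⟨ cong (n ^ d *_) (^-distribˡ-+-* 2 ((1 + x) * d + loss) (suc ℓ * d)) ⟨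
    n ^ d * 2 ^ ((1 + x) * d + loss + suc ℓ * d)
      <⟨ *-monoʳ-< (n ^ d) {{m^n≢0 n d}} (^-monoʳ-< 2 ≤-refl exponents) ⟩
    n ^ d * 2 ^ (x * t) ∎
    where
    regroup : ∀ a b c e → a * b * c * e ≡ a * (b * c * e)
    regroup = solve-∀

  1≤s : 1 ≤ s
  1≤s = ≤-trans 1≤p p≤s

  -- `υ * p ≤ 2 * s` turns the first summand of `x` into the term in `s * s`; `s ≤ υ * p` and
  -- `w * υ ≤ ℓ` turn `w` into the exponent of `Δ`.
  order-exponent : (1 + x) * (p * s) < 134 * q * 3 ^ q * d * s * s + ℓ * (134 * p * p)
  order-exponent = begin-strict
    (1 + x) * (p * s)
      ≡⟨ expand q d υ w p s ⟩
    64 * (q * q * d) * (υ * p) * s + w * p * s + 5 * (p * s)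
      ≤⟨ +-mono-≤ (+-mono-≤ (*-monoˡ-≤ s (*-monoʳ-≤ (64 * (q * q * d)) υp≤2s)) w-part)
                  (*-monoʳ-≤ 5 (*-monoˡ-≤ s p≤s)) ⟩
    64 * (q * q * d) * (2 * s) * s + ℓ * (p * p) + 5 * (s * s)
      <⟨ n<1+n _ ⟩
    1 + (64 * (q * q * d) * (2 * s) * s + ℓ * (p * p) + 5 * (s * s))
      ≤⟨ +-monoˡ-≤ _ (*-mono-≤ 1≤s 1≤s) ⟩
    s * s + (64 * (q * q * d) * (2 * s) * s + ℓ * (p * p) + 5 * (s * s))
      ≡⟨ gather (q * q * d) (s * s) (ℓ * (p * p)) s ⟩
    -- The constant 134 is 128 + 6: twice the 64 of `x`, then `1 + 4` from `1 + x` and one unit for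
    -- strictness.
    128 * (q * q * d * (s * s)) + 6 * (s * s) + ℓ * (p * p)
      ≤⟨ +-monoˡ-≤ (ℓ * (p * p)) (+-monoʳ-≤ (128 * (q * q * d * (s * s)))
           (*-monoʳ-≤ 6 (m≤n*m (s * s) (q * q * d) {{m*n≢0 (q * q) d {{m*n≢0 q q}}}}))) ⟩
    128 * (q * q * d * (s * s)) + 6 * (q * q * d * (s * s)) + ℓ * (p * p)
      ≡⟨ collect q d s (ℓ * (p * p)) ⟩
    134 * q * q * d * s * s + ℓ * (p * p)
      ≤⟨ +-mono-≤ (*-monoˡ-≤ s (*-monoˡ-≤ s (*-monoˡ-≤ d (*-monoʳ-≤ (134 * q) (n≤3^n q)))))
                  (*-monoʳ-≤ ℓ (*-monoˡ-≤ p (m≤n*m p 134))) ⟩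
    134 * q * 3 ^ q * d * s * s + ℓ * (134 * p * p) ∎
    where
    expand : ∀ q d υ w p s → (1 + (64 * (q * q * (d * υ)) + (4 + w))) * (p * s)
           ≡ 64 * (q * q * d) * (υ * p) * s + w * p * s + 5 * (p * s)
    expand = solve-∀
    gather : ∀ g y z s → y + (64 * g * (2 * s) * s + z + 5 * y) ≡ 128 * (g * (s * s)) + 6 * y + z
    gather = solve-∀
    collect : ∀ q d s z → 128 * (q * q * d * (s * s)) + 6 * (q * q * d * (s * s)) + z ≡ 134 * q * q * d * s * s + z
    collect = solve-∀
    w-part : w * p * s ≤ ℓ * (p * p)
    w-part = begin
      w * p * s         ≤⟨ *-monoʳ-≤ (w * p) s≤υp ⟩
      w * p * (υ * p)   ≡⟨ regroup w p υ ⟩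
      w * υ * (p * p)   ≤⟨ *-monoˡ-≤ (p * p) wυ≤ℓ ⟩
      ℓ * (p * p)       ∎
      where
      regroup : ∀ w p υ → w * p * (υ * p) ≡ w * υ * (p * p)
      regroup = solve-∀

  order-bound : ∀ Δ → 2 ^ ℓ ≤ Δ → N ^ (p * s) < 2 ^ (134 * q * 3 ^ q * d * s * s) * Δ ^ (134 * p * p) * n ^ (p * s)
  order-bound Δ 2^ℓ≤Δ = begin-strict
    N ^ (p * s)
      ≡⟨ N^ (p * s) ⟩
    n ^ (p * s) * 2 ^ ((1 + x) * (p * s))
      <⟨ *-monoʳ-< (n ^ (p * s)) {{m^n≢0 n (p * s)}} (^-monoʳ-< 2 ≤-refl order-exponent) ⟩
    n ^ (p * s) * 2 ^ (E + ℓ * (134 * p * p))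
      ≡⟨ cong (n ^ (p * s) *_) (trans (^-distribˡ-+-* 2 E (ℓ * (134 * p * p)))
                                       (cong (2 ^ E *_) (sym (^-*-assoc 2 ℓ (134 * p * p))))) ⟩
    n ^ (p * s) * (2 ^ E * (2 ^ ℓ) ^ (134 * p * p))
      ≤⟨ *-monoʳ-≤ (n ^ (p * s)) (*-monoʳ-≤ (2 ^ E) (^-monoˡ-≤ (134 * p * p) 2^ℓ≤Δ)) ⟩
    n ^ (p * s) * (2 ^ E * Δ ^ (134 * p * p))
      ≡⟨ *-comm (n ^ (p * s)) _ ⟩
    2 ^ E * Δ ^ (134 * p * p) * n ^ (p * s) ∎
    where
    E = 134 * q * 3 ^ q * d * s * s

-- `δ` is the fraction `p / s`. Raising both sides to the power `p * s` makes the exponents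
-- integral: `1 / δ` becomes `s * s` and `δ` becomes `p * p`.
theorem2p1 : Σ ℕ λ c →
    ∀ (n d Δ q : ℕ) (H : Graph n) →
    1 ≤ n → 1 ≤ d → 1 ≤ Δ →
    Degenerate H d Δ → IsChromaticNumber H q →
    ∀ (r : ℕ) → IsRamseyNumber H r →
    ∀ (p s : ℕ) → 1 ≤ p → p ≤ s →
    r ^ (p * s) < 2 ^ (c * q * 3 ^ q * d * s * s) * Δ ^ (c * p * p) * n ^ (p * s)
theorem2p1 = 134 , λ n d Δ q H 1≤n 1≤d 1≤Δ (π , degenerate) ((κ , proper) , _) r (_ , r-least) p s 1≤p p≤s →
  let
    ℓ , 2^ℓ≤Δ , Δ<2^ℓ+1 = binary-log Δ 1≤Δ
    -- `q` is positive because some vertex of `H` receives a colour.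
    open Parameters n d q p s ℓ 1≤n 1≤d (Fin⇒1≤ (κ (fromℕ< 1≤n))) 1≤p p≤s
    1≤N : 1 ≤ N
    1≤N = *-mono-≤ (*-mono-≤ (s≤s (z≤n {1})) 1≤n) (m^n>0 2 x)
    arrows : Arrows N H
    arrows χ = Embedding.mono-copy H χ π degenerate κ proper 1≤n 1≤N Δ<2^ℓ+1
      (Monochromatic.blocks χ q n d t x (2 ^ suc ℓ) 1≤n refl few-choices weight-budget)
  in ≤-<-trans (^-monoˡ-≤ (p * s) (r-least N 1≤N arrows)) (order-bound Δ 2^ℓ≤Δ)
  where
  Fin⇒1≤ : ∀ {q} → Fin q → 1 ≤ q
  Fin⇒1≤ {suc _} _ = s≤s z≤n
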